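{- Let $P$ and $Q$ be face posets of $d$-dimensional convex polytopes, with maximum elements $\hat 1^P,\hat 1^Q$, and let $R$ be the face poset of a $(d-1)$-dimensional convex polytope, with maximum element $\hat 1^R$. Suppose $F_P\in P$ and $F_Q\in Q$ are elements of rank $d-1$ and $\phi^P:R\to[\emptyset,F_P]$, $\phi^Q:R\to[\emptyset,F_Q]$ are rank-preserving poset isomorphisms. Define the poset $Gl=Gl(P,Q,R)$ with underlying set the disjoint union $$\bigl(P\setminus([\emptyset,F_P]\cup\{\hat 1^P\})\bigr)\ \sqcup\ \bigl(Q\setminus([\emptyset,F_Q]\cup\{\hat 1^Q\})\bigr)\ \sqcup\ \bigl(R\setminus\{\hat 1^R\}\bigr)\ \sqcup\ \{\hat 1\},$$ ranks inherited from $P,Q,R$ and $|\hat 1|=d$, and order: $\hat 1$ is above every element; two elements of the $P$-part (resp. $Q$-part, $R$-part) compare as in $P$ (resp. $Q$, $R$); for $a$ in the $P$-part and $r$ in the $R$-part, $a\le r$ iff $a\le_P\phi^P(r)$ and $r\le a$ iff $\phi^P(r)\le_P a$; likewise for the $Q$-part with $\phi^Q$; elements of the $P$-part and the $Q$-part are incomparable. Then $$\mathcal{M}_{Gl}(z)=\mathcal{M}_P(z)+\mathcal{M}_Q(z)-\mathcal{M}_R(z)-1+z-(1-z)\,g^R_{d-1}(z).$$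
   Context: The face poset of a convex polytope with vertex set $V$ is the set of vertex sets of its faces (including the whole polytope) together with $\emptyset$, ordered by inclusion, ranked by dimension ($|\emptyset|=-1$). $[a,b]=\{s:a\le s\le b\}$. (Geometrically, $Gl$ is the face poset of the polytope obtained by gluing the two polytopes along a common facet isomorphic to the polytope of $R$ and deleting that interior facet, assuming no faces merge.) The Möbius function $\mu$ is $\mu[p,p]=1$, $\mu[p,q]=-\sum_{p\le s<q}\mu[p,s]$ for $p<q$, $0$ if $p\not\le q$; $\mu_z[p,q]=\mu[p,q]z^{|q|-|p|}$; $\mathcal{M}_P(z)=\sum_{p\le q\in P}\mu_z[p,q]$; the top polynomial of $R$ (rank $d-1$) is $g^R_{d-1}(z)=\sum_{p\le q,\ |p|\le d-1\le|q|}\mu_z[p,q]$. -}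

module Defs where

open import Level using (Level; _⊔_; 0ℓ) renaming (suc to lsuc)
open import Algebra.Bundles using (CommutativeRing)
import Algebra.Definitions.RawMonoid as RawMonoidDefs
open import Data.Empty using () renaming (⊥ to Empty)
open import Data.Fin.Base using (Fin)
import Data.Fin.Induction as FinInd
open import Data.Fin.Subset as Subset using (Subset)
open import Data.Integer.Base as ℤ using (ℤ; +_; 0ℤ; 1ℤ; -1ℤ; ∣_∣)
import Data.Integer.Properties as ℤₚ
open import Data.List.Base using (List; []; _∷_; _++_; map; foldr; filter; lookup; length; replicate)
open import Data.List.Membership.Propositional using (_∈_)
open import Data.List.Membership.Propositional.Properties using (∈-map⁺; ∈-map⁻; ∈-++⁺ˡ; ∈-++⁺ʳ; ∈-++⁻)
open import Data.List.Properties using (filter-accept; filter-reject)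
open import Data.List.Relation.Unary.All as All using (All)
import Data.List.Relation.Unary.AllPairs as AllPairs
open import Data.List.Relation.Unary.Any as Any using (here; there)
open import Data.List.Relation.Unary.Any.Properties using (lookup-index)
open import Data.List.Relation.Unary.Unique.Propositional using (Unique)
import Data.List.Relation.Unary.Unique.Propositional.Properties as Uniqueₚ
open import Data.Nat.Base using (ℕ; zero; suc)
open import Data.Product.Base using (Σ; ∃; ∃-syntax; _×_; _,_; proj₁; proj₂)
open import Data.Sum.Base using (_⊎_; inj₁; inj₂)
open import Data.Unit.Base using (⊤; tt)
open import Function.Base using (_on_; _∘_)
open import Function.Bundles using (_⇔_)
open import Function.Definitions using (Injective)
import Induction.WellFounded as WF
open import Relation.Binary.Core using (Rel)
open import Relation.Binary.Definitions using (Minimum; Maximum; Transitive; Antisymmetric; Reflexive; Decidable)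
open import Relation.Binary.Structures using (IsTotalOrder; IsPartialOrder; IsDecPartialOrder)
open import Relation.Binary.Morphism.Structures using (IsOrderIsomorphism)
import Relation.Binary.Construct.NonStrictToStrict as ToStrict
import Relation.Binary.Construct.On as On
open import Relation.Binary.PropositionalEquality
  using (_≡_; _≢_; refl; sym; trans; cong; subst; subst₂; isEquivalence)
open import Relation.Nullary using (¬_; yes; no; contradiction)
open import Relation.Nullary.Decidable using (_×-dec_; map′)
open import Relation.Unary using (Pred; _∪_; ｛_｝) renaming (Decidable to Decidable₁)
open import Relation.Unary.Properties using (_∪?_)

------------------------------------------------------------------------
-- Convex polytopes

-- The scalars are an arbitrary ordered field; ℝ is the case of interest.
record OrderedField (c ℓ₁ ℓ₂ : Level) : Set (lsuc (c ⊔ ℓ₁ ⊔ ℓ₂)) where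
  field
    commutativeRing : CommutativeRing c ℓ₁

  open CommutativeRing commutativeRing public

  infix 4 _≤_

  field
    _≤_          : Rel Carrier ℓ₂
    isTotalOrder : IsTotalOrder _≈_ _≤_
    +-monoʳ-≤    : ∀ x {y z} → y ≤ z → x + y ≤ x + z
    *-nonNeg     : ∀ {x y} → 0# ≤ x → 0# ≤ y → 0# ≤ x * y
    0≉1          : ¬ (0# ≈ 1#)
    inverse      : ∀ x → ¬ (x ≈ 0#) → ∃[ y ] x * y ≈ 1#

module Convex {c ℓ₁ ℓ₂ : Level} (K : OrderedField c ℓ₁ ℓ₂) where

  open OrderedField K
  open RawMonoidDefs +-rawMonoid using (sum)

  Point : ℕ → Set c
  Point n = Fin n → Carrier

  infix 4 _≋_
  _≋_ : ∀ {n} → Rel (Point n) ℓ₁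
  x ≋ y = ∀ j → x j ≈ y j

  infix 8 _·_
  _·_ : ∀ {n} → Point n → Point n → Carrier
  a · x = sum λ j → a j * x j

  combination : ∀ {n m} → (Fin m → Carrier) → (Fin m → Point n) → Point n
  combination w v j = sum λ i → w i * v i j

  Conv : ∀ {n m} → (Fin m → Point n) → Pred (Point n) (c ⊔ ℓ₁ ⊔ ℓ₂)
  Conv v x = ∃[ w ] ((∀ i → 0# ≤ w i) × sum w ≈ 1# × x ≋ combination w v)

  AffinelyIndependent : ∀ {n k} → (Fin k → Point n) → Set (c ⊔ ℓ₁)
  AffinelyIndependent x =
    ∀ w → sum w ≈ 0# → combination w x ≋ (λ _ → 0#) → ∀ i → w i ≈ 0#

  IndependentFamily : ∀ {n ℓ} → Pred (Point n) ℓ → ℕ → Set (c ⊔ ℓ₁ ⊔ ℓ)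
  IndependentFamily {n} S k =
    Σ (Fin k → Point n) λ x → (∀ i → S (x i)) × AffinelyIndependent x

  -- dim S is one less than the largest number of affinely independent points
  -- of S (so dim ∅ = -1).  Subfamilies of independent families are
  -- independent, so excluding suc k points excludes all larger families.
  HasDimension : ∀ {n ℓ} → Pred (Point n) ℓ → ℤ → Set (c ⊔ ℓ₁ ⊔ ℓ)
  HasDimension S d = ∃[ k ] (+ k ≡ d ℤ.+ 1ℤ
                             × IndependentFamily S k
                             × ¬ IndependentFamily S (suc k))

  record Face {n m} (v : Fin m → Point n) : Set (c ⊔ ℓ₁ ⊔ ℓ₂) where
    field
      normal : Point n
      offset : Carrier
      valid  : ∀ x → Conv v x → normal · x ≤ offset

    points : Pred (Point n) (c ⊔ ℓ₁ ⊔ ℓ₂)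
    points x = Conv v x × normal · x ≈ offset

  IsVertex : ∀ {n m} → (Fin m → Point n) → Pred (Point n) (c ⊔ ℓ₁ ⊔ ℓ₂)
  IsVertex v x = Σ (Face v) λ Φ → ∀ y → Face.points Φ y ⇔ y ≋ x

  -- A polytope is presented by its vertices, listed without repetition; every
  -- polytope is the convex hull of its vertex set.
  record Polytope : Set (c ⊔ ℓ₁ ⊔ ℓ₂) where
    field
      ambient  : ℕ
      #V       : ℕ
      vertex   : Fin #V → Point ambient
      isVertex : ∀ i → IsVertex vertex (vertex i)
      distinct : Injective _≡_ _≋_ vertex

    points : Pred (Point ambient) (c ⊔ ℓ₁ ⊔ ℓ₂)
    points = Conv vertex

    IsVertexSetOf : Subset #V → Face vertex → Set (c ⊔ ℓ₁ ⊔ ℓ₂)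
    IsVertexSetOf S Φ = ∀ i → (i Subset.∈ S) ⇔ Face.points Φ (vertex i)

------------------------------------------------------------------------
-- Finite posets with a rank function

record RankedPoset : Set₁ where
  infix 4 _≤_
  field
    Carrier           : Set
    _≤_               : Rel Carrier 0ℓ
    isDecPartialOrder : IsDecPartialOrder _≡_ _≤_
    elements          : List Carrier
    complete          : ∀ p → p ∈ elements
    unique            : Unique elements
    rank              : Carrier → ℤ

  open IsDecPartialOrder isDecPartialOrder public
    using (_≟_; _≤?_; isPartialOrder; antisym; reflexive)
    renaming (refl to ≤-refl; trans to ≤-trans)

  open ToStrict _≡_ _≤_ public using (_<_)

  infix 4 _<?_
  _<?_ : Decidable _<_
  _<?_ = ToStrict.<-decidable _≡_ _≤_ _≟_ _≤?_

  [_,_] : Carrier → Carrier → Pred Carrier 0ℓ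
  [ a , b ] s = a ≤ s × s ≤ b

  [_,_]? : ∀ a b → Decidable₁ [ a , b ]
  [ a , b ]? s = (a ≤? s) ×-dec (s ≤? b)

  [_,_⟩ : Carrier → Carrier → Pred Carrier 0ℓ
  [ a , b ⟩ s = a ≤ s × s < b

  [_,_⟩? : ∀ a b → Decidable₁ [ a , b ⟩
  [ a , b ⟩? s = (a ≤? s) ×-dec (s <? b)

  <-wellFounded : WF.WellFounded _<_
  <-wellFounded = WF.Subrelation.wellFounded
                    (λ {p} {q} → index-mono p q)
                    (On.wellFounded index indices-wellFounded)
    where
    index : Carrier → Fin (length elements)
    index p = Any.index (complete p)

    lookup-idx : ∀ p → p ≡ lookup elements (index p)
    lookup-idx p = lookup-index (complete p)

    indices-wellFounded : WF.WellFounded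
      (ToStrict._<_ (_≡_ on lookup elements) (_≤_ on lookup elements))
    indices-wellFounded =
      FinInd.po-wellFounded (On.isPartialOrder (lookup elements) isPartialOrder)

    index-mono : ∀ p q → p < q →
      ToStrict._<_ (_≡_ on lookup elements) (_≤_ on lookup elements) (index p) (index q)
    index-mono p q = subst₂ _<_ (lookup-idx p) (lookup-idx q)

record Bounded (P : RankedPoset) : Set where
  open RankedPoset P
  field
    ∅       : Carrier
    1̂       : Carrier
    minimum : Minimum _≤_ ∅
    maximum : Maximum _≤_ 1̂

-- The face poset is only determined up to isomorphism here: vertexSet
-- identifies P with the set of vertex sets of faces, together with ∅.
record IsFacePoset {c ℓ₁ ℓ₂ : Level} {K : OrderedField c ℓ₁ ℓ₂}
                   (P : RankedPoset) (Π : Convex.Polytope K) : Set (c ⊔ ℓ₁ ⊔ ℓ₂) where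
  open RankedPoset P
  open Convex K
  open Polytope Π using (#V; vertex; IsVertexSetOf)
  field
    vertexSet : Carrier → Subset #V
    ≤⇔⊆       : ∀ p q → (p ≤ q) ⇔ (vertexSet p Subset.⊆ vertexSet q)
    isFace    : ∀ p → vertexSet p ≡ Subset.⊥
                    ⊎ Σ (Face vertex) (IsVertexSetOf (vertexSet p))
    hasFaces  : ∀ S (Φ : Face vertex) → IsVertexSetOf S Φ → ∃[ p ] vertexSet p ≡ S
    hasEmpty  : ∃[ p ] vertexSet p ≡ Subset.⊥
    rank-∅    : ∀ p → vertexSet p ≡ Subset.⊥ → rank p ≡ -1ℤ
    rank-dim  : ∀ p (Φ : Face vertex) → IsVertexSetOf (vertexSet p) Φ →
                HasDimension (Face.points Φ) (rank p)

------------------------------------------------------------------------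
-- Polynomials ℤ[z]

-- Coefficient lists, constant term first, up to trailing zeros.
ℤ[z] : Set
ℤ[z] = List ℤ

coeff : ℤ[z] → ℕ → ℤ
coeff []      _       = 0ℤ
coeff (a ∷ f) zero    = a
coeff (a ∷ f) (suc k) = coeff f k

infix 4 _≈ₚ_
_≈ₚ_ : Rel ℤ[z] 0ℓ
f ≈ₚ h = ∀ k → coeff f k ≡ coeff h k

infixl 6 _+ₚ_ _-ₚ_
infixl 7 _*ₚ_ _•_

_+ₚ_ : ℤ[z] → ℤ[z] → ℤ[z]
[]      +ₚ h       = h
(a ∷ f) +ₚ []      = a ∷ f
(a ∷ f) +ₚ (b ∷ h) = (a ℤ.+ b) ∷ (f +ₚ h)

_•_ : ℤ → ℤ[z] → ℤ[z]
a • f = map (a ℤ.*_) f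

_-ₚ_ : ℤ[z] → ℤ[z] → ℤ[z]
f -ₚ h = f +ₚ -1ℤ • h

_*ₚ_ : ℤ[z] → ℤ[z] → ℤ[z]
[]      *ₚ h = []
(a ∷ f) *ₚ h = a • h +ₚ (0ℤ ∷ f *ₚ h)

1ₚ : ℤ[z]
1ₚ = 1ℤ ∷ []

z : ℤ[z]
z = 0ℤ ∷ 1ℤ ∷ []

z^_ : ℕ → ℤ[z]
z^ k = replicate k 0ℤ ++ 1ₚ

------------------------------------------------------------------------
-- Möbius function and Möbius polynomials

∑ℤ : {A : Set} → List A → (A → ℤ) → ℤ
∑ℤ xs f = foldr (λ x n → f x ℤ.+ n) 0ℤ xs

∑ₚ : {A : Set} → List A → (A → ℤ[z]) → ℤ[z]
∑ₚ xs f = foldr (λ x h → f x +ₚ h) [] xs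

module Möbius (P : RankedPoset) where
  open RankedPoset P

  private
    term : ∀ p q → (∀ {s} → s < q → ℤ) → Carrier → ℤ
    term p q rec s with [ p , q ⟩? s
    ... | yes (_ , s<q) = rec s<q
    ... | no  _         = 0ℤ

    step : ∀ p q → (∀ {s} → s < q → ℤ) → ℤ
    step p q rec with p ≟ q | p ≤? q
    ... | yes _ | _     = 1ℤ
    ... | no  _ | yes _ = ℤ.- ∑ℤ elements (term p q rec)
    ... | no  _ | no  _ = 0ℤ

  -- μ-refl, μ-< and μ-≰ below are the defining equations of the Möbius function.
  μ : Carrier → Carrier → ℤ
  μ p = WF.All.wfRec <-wellFounded _ (λ _ → ℤ) (step p)

  private
    ∑-cong : ∀ xs {f h : Carrier → ℤ} → (∀ s → f s ≡ h s) → ∑ℤ xs f ≡ ∑ℤ xs h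
    ∑-cong []       e = refl
    ∑-cong (s ∷ xs) e rewrite e s | ∑-cong xs e = refl

    term-ext : ∀ p q {f h : ∀ {s} → s < q → ℤ} →
               (∀ {s} (s<q : s < q) → f s<q ≡ h s<q) → ∀ s → term p q f s ≡ term p q h s
    term-ext p q e s with [ p , q ⟩? s
    ... | yes (_ , s<q) = e s<q
    ... | no  _         = refl

    step-ext : ∀ p q {f h : ∀ {s} → s < q → ℤ} →
               (∀ {s} (s<q : s < q) → f s<q ≡ h s<q) → step p q f ≡ step p q h
    step-ext p q e with p ≟ q | p ≤? q
    ... | yes _ | _     = refl
    ... | no  _ | yes _ = cong ℤ.-_ (∑-cong elements (term-ext p q e))
    ... | no  _ | no  _ = refl

    unfold : ∀ p q → μ p q ≡ step p q (λ {s} _ → μ p s)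
    unfold p q = WF.FixPoint.unfold-wfRec <-wellFounded (λ _ → ℤ) (step p) (λ q e → step-ext p q e)

    ∑-filter : ∀ p q (h : Carrier → ℤ) xs →
               ∑ℤ xs (term p q (λ {s} _ → h s)) ≡ ∑ℤ (filter [ p , q ⟩? xs) h
    ∑-filter p q h []       = refl
    ∑-filter p q h (s ∷ xs) with [ p , q ⟩? s
    ... | yes i = trans (cong (λ n → h s ℤ.+ n) (∑-filter p q h xs))
                        (sym (cong (λ l → ∑ℤ l h) (filter-accept [ p , q ⟩? i)))
    ... | no ¬i = trans (trans (ℤₚ.+-identityˡ _) (∑-filter p q h xs))
                        (sym (cong (λ l → ∑ℤ l h) (filter-reject [ p , q ⟩? ¬i)))

  μ-refl : ∀ p → μ p p ≡ 1ℤ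
  μ-refl p = trans (unfold p p) eq
    where
    eq : step p p (λ {s} _ → μ p s) ≡ 1ℤ
    eq with p ≟ p | p ≤? p
    ... | yes _   | _ = refl
    ... | no p≢p | _ = contradiction refl p≢p

  μ-< : ∀ p q → p < q →
        μ p q ≡ ℤ.- ∑ℤ (filter [ p , q ⟩? elements) (μ p)
  μ-< p q (p≤q , p≢q) = trans (unfold p q) eq
    where
    eq : step p q (λ {s} _ → μ p s)
       ≡ ℤ.- ∑ℤ (filter [ p , q ⟩? elements) (μ p)
    eq with p ≟ q | p ≤? q
    ... | yes p≡q | _      = contradiction p≡q p≢q
    ... | no _    | yes _  = cong ℤ.-_ (∑-filter p q (μ p) elements)
    ... | no _    | no p≰q = contradiction p≤q p≰q

  μ-≰ : ∀ p q → ¬ (p ≤ q) → μ p q ≡ 0ℤ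
  μ-≰ p q p≰q = trans (unfold p q) eq
    where
    eq : step p q (λ {s} _ → μ p s) ≡ 0ℤ
    eq with p ≟ q | p ≤? q
    ... | yes p≡q | _       = contradiction (reflexive p≡q) p≰q
    ... | no _    | yes p≤q = contradiction p≤q p≰q
    ... | no _    | no _    = refl

  -- Only used for p ≤ q, where the exponent |q| - |p| is nonnegative.
  μ-z : Carrier → Carrier → ℤ[z]
  μ-z p q = μ p q • (z^ ∣ rank q ℤ.- rank p ∣)

ℳ : RankedPoset → ℤ[z]
ℳ P = ∑ₚ elements λ p → ∑ₚ (filter (p ≤?_) elements) λ q → μ-z p q
  where open RankedPoset P
        open Möbius P

g : (P : RankedPoset) → ℤ → ℤ[z]
g P k = ∑ₚ (filter (λ p → rank p ℤₚ.≤? k) elements) λ p →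
        ∑ₚ (filter (λ q → (p ≤? q) ×-dec (k ℤₚ.≤? rank q)) elements) λ q →
        μ-z p q
  where open RankedPoset P
        open Möbius P

------------------------------------------------------------------------
-- Gluing

record RankIso (R P : RankedPoset) (a b : RankedPoset.Carrier P) : Set where
  private
    module R = RankedPoset R
    module P = RankedPoset P
  field
    to                 : R.Carrier → ∃ P.[ a , b ]
    isOrderIsomorphism : IsOrderIsomorphism _≡_ (_≡_ on proj₁) R._≤_ (P._≤_ on proj₁) to
    rank-preserving    : ∀ r → P.rank (proj₁ (to r)) ≡ R.rank r

  φ : R.Carrier → P.Carrier
  φ r = proj₁ (to r)

  φ-mono : ∀ {r s} → r R.≤ s → φ r P.≤ φ s
  φ-mono = IsOrderIsomorphism.mono isOrderIsomorphism

  φ-cancel : ∀ {r s} → φ r P.≤ φ s → r R.≤ s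
  φ-cancel = IsOrderIsomorphism.cancel isOrderIsomorphism

infixl 6 _∖_
_∖_ : (A : Set) → Pred A 0ℓ → Set
A ∖ D = ∃[ a ] ¬ D a

-- Negations are definitionally proof irrelevant.
∖-≡ : ∀ {A : Set} {D : Pred A 0ℓ} {x y : A ∖ D} → proj₁ x ≡ proj₁ y → x ≡ y
∖-≡ refl = refl

module _ {A : Set} {D : Pred A 0ℓ} (D? : Decidable₁ D) where

  list-∖ : List A → List (A ∖ D)
  list-∖ []       = []
  list-∖ (a ∷ as) with D? a
  ... | yes _  = list-∖ as
  ... | no ¬Da = (a , ¬Da) ∷ list-∖ as

  list-∖-complete : ∀ {as} (x : A ∖ D) → proj₁ x ∈ as → x ∈ list-∖ as
  list-∖-complete {a ∷ as} x@(_ , ¬Dx) x∈ with D? a | x∈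
  ... | yes Da | here refl = contradiction Da ¬Dx
  ... | yes _  | there x∈as = list-∖-complete x x∈as
  ... | no _   | here refl = here refl
  ... | no _   | there x∈as = there (list-∖-complete x x∈as)

  list-∖-sound : ∀ {as} {x : A ∖ D} → x ∈ list-∖ as → proj₁ x ∈ as
  list-∖-sound {a ∷ as} x∈ with D? a | x∈
  ... | yes _ | x∈′       = there (list-∖-sound x∈′)
  ... | no _  | here refl = here refl
  ... | no _  | there x∈′ = there (list-∖-sound x∈′)

  list-∖-unique : ∀ {as} → Unique as → Unique (list-∖ as)
  list-∖-unique {[]}     _ = AllPairs.[]
  list-∖-unique {a ∷ as} (a∉ AllPairs.∷ u) with D? a
  ... | yes _ = list-∖-unique u
  ... | no _  = All.tabulate (λ x∈ a≡x → All.lookup a∉ (list-∖-sound x∈) (cong proj₁ a≡x))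
                AllPairs.∷ list-∖-unique u

module Gluing
  {P Q R : RankedPoset} (d : ℤ)
  (boundsP : Bounded P) (boundsQ : Bounded Q) (boundsR : Bounded R)
  {FP : RankedPoset.Carrier P} {FQ : RankedPoset.Carrier Q}
  (isoP : RankIso R P (Bounded.∅ boundsP) FP)
  (isoQ : RankIso R Q (Bounded.∅ boundsQ) FQ)
  where

  private
    module P = RankedPoset P
    module Q = RankedPoset Q
    module R = RankedPoset R

  open Bounded boundsP using () renaming (∅ to ∅P; 1̂ to 1P; minimum to ∅P≤_)
  open Bounded boundsQ using () renaming (∅ to ∅Q; 1̂ to 1Q; minimum to ∅Q≤_)
  open Bounded boundsR using () renaming (1̂ to 1R)
  open RankIso isoP using () renaming (to to toP; φ to φP; φ-mono to φP-mono; φ-cancel to φP-cancel)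
  open RankIso isoQ using () renaming (to to toQ; φ to φQ; φ-mono to φQ-mono; φ-cancel to φQ-cancel)

  DP : Pred P.Carrier 0ℓ
  DP = P.[ ∅P , FP ] ∪ ｛ 1P ｝

  DQ : Pred Q.Carrier 0ℓ
  DQ = Q.[ ∅Q , FQ ] ∪ ｛ 1Q ｝

  DR : Pred R.Carrier 0ℓ
  DR = ｛ 1R ｝

  data Element : Set where
    inP : P.Carrier ∖ DP → Element
    inQ : Q.Carrier ∖ DQ → Element
    inR : R.Carrier ∖ DR → Element
    top : Element

  infix 4 _≤_
  _≤_ : Rel Element 0ℓ
  _             ≤ top           = ⊤
  top           ≤ inP _         = Empty
  top           ≤ inQ _         = Empty
  top           ≤ inR _         = Empty
  inP (a , _)   ≤ inP (b , _)   = a P.≤ b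
  inQ (a , _)   ≤ inQ (b , _)   = a Q.≤ b
  inR (r , _)   ≤ inR (s , _)   = r R.≤ s
  inP (a , _)   ≤ inR (r , _)   = a P.≤ φP r
  inR (r , _)   ≤ inP (a , _)   = φP r P.≤ a
  inQ (a , _)   ≤ inR (r , _)   = a Q.≤ φQ r
  inR (r , _)   ≤ inQ (a , _)   = φQ r Q.≤ a
  inP _         ≤ inQ _         = Empty
  inQ _         ≤ inP _         = Empty

  rank : Element → ℤ
  rank (inP (a , _)) = P.rank a
  rank (inQ (a , _)) = Q.rank a
  rank (inR (r , _)) = R.rank r
  rank top           = d

  private
    P≰R : ∀ {a r} → ¬ DP a → ¬ (a P.≤ φP r)
    P≰R {a} {r} a∉ a≤ = a∉ (inj₁ ((∅P≤ a) , P.≤-trans a≤ (proj₂ (proj₂ (toP r)))))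

    Q≰R : ∀ {a r} → ¬ DQ a → ¬ (a Q.≤ φQ r)
    Q≰R {a} {r} a∉ a≤ = a∉ (inj₁ ((∅Q≤ a) , Q.≤-trans a≤ (proj₂ (proj₂ (toQ r)))))

    ≤-reflexive : ∀ {x y} → x ≡ y → x ≤ y
    ≤-reflexive {inP _} refl = P.≤-refl
    ≤-reflexive {inQ _} refl = Q.≤-refl
    ≤-reflexive {inR _} refl = R.≤-refl
    ≤-reflexive {top}   refl = tt

    ≤-trans : Transitive _≤_
    ≤-trans {inP _} {inP _} {inP _} p q = P.≤-trans p q
    ≤-trans {inP _} {inP _} {inR _} p q = P.≤-trans p q
    ≤-trans {inP (_ , a∉)} {inR (r , _)} {inP _} p q = contradiction p (P≰R {r = r} a∉)
    ≤-trans {inP (_ , a∉)} {inR (r , _)} {inQ _} p q = contradiction p (P≰R {r = r} a∉)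
    ≤-trans {inP (_ , a∉)} {inR (r , _)} {inR _} p q = contradiction p (P≰R {r = r} a∉)
    ≤-trans {inQ _} {inQ _} {inQ _} p q = Q.≤-trans p q
    ≤-trans {inQ _} {inQ _} {inR _} p q = Q.≤-trans p q
    ≤-trans {inQ (_ , a∉)} {inR (r , _)} {inP _} p q = contradiction p (Q≰R {r = r} a∉)
    ≤-trans {inQ (_ , a∉)} {inR (r , _)} {inQ _} p q = contradiction p (Q≰R {r = r} a∉)
    ≤-trans {inQ (_ , a∉)} {inR (r , _)} {inR _} p q = contradiction p (Q≰R {r = r} a∉)
    ≤-trans {inR _} {inP _} {inP _} p q = P.≤-trans p q
    ≤-trans {inR _} {inP (_ , a∉)} {inR (r , _)} p q = contradiction q (P≰R {r = r} a∉)
    ≤-trans {inR _} {inQ _} {inQ _} p q = Q.≤-trans p q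
    ≤-trans {inR _} {inQ (_ , a∉)} {inR (r , _)} p q = contradiction q (Q≰R {r = r} a∉)
    ≤-trans {inR _} {inR _} {inP _} p q = P.≤-trans (φP-mono p) q
    ≤-trans {inR _} {inR _} {inQ _} p q = Q.≤-trans (φQ-mono p) q
    ≤-trans {inR _} {inR _} {inR _} p q = R.≤-trans p q
    ≤-trans {inP _} {_} {top} p q = tt
    ≤-trans {inQ _} {_} {top} p q = tt
    ≤-trans {inR _} {_} {top} p q = tt
    ≤-trans {top} {top} p q = q

    ≤-antisym : Antisymmetric _≡_ _≤_
    ≤-antisym {inP _} {inP _} p q = cong inP (∖-≡ (P.antisym p q))
    ≤-antisym {inQ _} {inQ _} p q = cong inQ (∖-≡ (Q.antisym p q))
    ≤-antisym {inR _} {inR _} p q = cong inR (∖-≡ (R.antisym p q))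
    ≤-antisym {inP (_ , a∉)} {inR (r , _)} p q = contradiction p (P≰R {r = r} a∉)
    ≤-antisym {inR (r , _)} {inP (_ , a∉)} p q = contradiction q (P≰R {r = r} a∉)
    ≤-antisym {inQ (_ , a∉)} {inR (r , _)} p q = contradiction p (Q≰R {r = r} a∉)
    ≤-antisym {inR (r , _)} {inQ (_ , a∉)} p q = contradiction q (Q≰R {r = r} a∉)
    ≤-antisym {top} {top} p q = refl

    infix 4 _≟_ _≤?_
    _≟_ : Decidable {A = Element} _≡_
    inP (a , _) ≟ inP (b , _) = map′ (λ e → cong inP (∖-≡ e)) (λ { refl → refl }) (a P.≟ b)
    inP _       ≟ inQ _       = no λ ()
    inP _       ≟ inR _       = no λ ()
    inP _       ≟ top         = no λ ()
    inQ _       ≟ inP _       = no λ ()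
    inQ (a , _) ≟ inQ (b , _) = map′ (λ e → cong inQ (∖-≡ e)) (λ { refl → refl }) (a Q.≟ b)
    inQ _       ≟ inR _       = no λ ()
    inQ _       ≟ top         = no λ ()
    inR _       ≟ inP _       = no λ ()
    inR _       ≟ inQ _       = no λ ()
    inR (a , _) ≟ inR (b , _) = map′ (λ e → cong inR (∖-≡ e)) (λ { refl → refl }) (a R.≟ b)
    inR _       ≟ top         = no λ ()
    top         ≟ inP _       = no λ ()
    top         ≟ inQ _       = no λ ()
    top         ≟ inR _       = no λ ()
    top         ≟ top         = yes refl

    _≤?_ : Decidable _≤_
    inP (a , _) ≤? inP (b , _) = a P.≤? b
    inP _       ≤? inQ _       = no λ ()
    inP (a , _) ≤? inR (r , _) = a P.≤? φP r
    inP _       ≤? top         = yes tt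
    inQ _       ≤? inP _       = no λ ()
    inQ (a , _) ≤? inQ (b , _) = a Q.≤? b
    inQ (a , _) ≤? inR (r , _) = a Q.≤? φQ r
    inQ _       ≤? top         = yes tt
    inR (r , _) ≤? inP (a , _) = φP r P.≤? a
    inR (r , _) ≤? inQ (a , _) = φQ r Q.≤? a
    inR (r , _) ≤? inR (s , _) = r R.≤? s
    inR _       ≤? top         = yes tt
    top         ≤? inP _       = no λ ()
    top         ≤? inQ _       = no λ ()
    top         ≤? inR _       = no λ ()
    top         ≤? top         = yes tt

  elementsP : List (P.Carrier ∖ DP)
  elementsP = list-∖ (P.[ ∅P , FP ]? ∪? (1P P.≟_)) P.elements

  elementsQ : List (Q.Carrier ∖ DQ)
  elementsQ = list-∖ (Q.[ ∅Q , FQ ]? ∪? (1Q Q.≟_)) Q.elements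

  elementsR : List (R.Carrier ∖ DR)
  elementsR = list-∖ (1R R.≟_) R.elements

  elements : List Element
  elements = map inP elementsP ++ map inQ elementsQ ++ map inR elementsR ++ top ∷ []

  private
    complete : ∀ x → x ∈ elements
    complete (inP x) = ∈-++⁺ˡ (∈-map⁺ inP (list-∖-complete _ x (P.complete (proj₁ x))))
    complete (inQ x) = ∈-++⁺ʳ (map inP elementsP)
      (∈-++⁺ˡ (∈-map⁺ inQ (list-∖-complete _ x (Q.complete (proj₁ x)))))
    complete (inR x) = ∈-++⁺ʳ (map inP elementsP) (∈-++⁺ʳ (map inQ elementsQ)
      (∈-++⁺ˡ (∈-map⁺ inR (list-∖-complete _ x (R.complete (proj₁ x))))))
    complete top     = ∈-++⁺ʳ (map inP elementsP) (∈-++⁺ʳ (map inQ elementsQ)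
      (∈-++⁺ʳ (map inR elementsR) (here refl)))

    data Tag : Set where
      tP tQ tR tT : Tag

    tag : Element → Tag
    tag (inP _) = tP
    tag (inQ _) = tQ
    tag (inR _) = tR
    tag top     = tT

    tag-map : ∀ {A : Set} (f : A → Element) {t xs x} → (∀ a → tag (f a) ≡ t) →
              x ∈ map f xs → tag x ≡ t
    tag-map f e x∈ with ∈-map⁻ f x∈
    ... | a , _ , refl = e a

    tag-R : ∀ {x} → x ∈ map inR elementsR ++ top ∷ [] → tag x ≡ tR ⊎ tag x ≡ tT
    tag-R x∈ with ∈-++⁻ (map inR elementsR) x∈
    ... | inj₁ x∈R         = inj₁ (tag-map inR (λ _ → refl) x∈R)
    ... | inj₂ (here refl) = inj₂ refl

    tag-Q : ∀ {x} → x ∈ map inQ elementsQ ++ map inR elementsR ++ top ∷ [] →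
            tag x ≡ tQ ⊎ tag x ≡ tR ⊎ tag x ≡ tT
    tag-Q x∈ with ∈-++⁻ (map inQ elementsQ) x∈
    ... | inj₁ x∈Q = inj₁ (tag-map inQ (λ _ → refl) x∈Q)
    ... | inj₂ x∈R = inj₂ (tag-R x∈R)

    P#Q : ∀ {x} → tag x ≡ tP → ¬ (tag x ≡ tQ ⊎ tag x ≡ tR ⊎ tag x ≡ tT)
    P#Q {inP _} _ (inj₁ ())
    P#Q {inP _} _ (inj₂ (inj₁ ()))
    P#Q {inP _} _ (inj₂ (inj₂ ()))

    Q#R : ∀ {x} → tag x ≡ tQ → ¬ (tag x ≡ tR ⊎ tag x ≡ tT)
    Q#R {inQ _} _ (inj₁ ())
    Q#R {inQ _} _ (inj₂ ())

    R#T : ∀ {x} → tag x ≡ tR → ¬ (x ∈ top ∷ [])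
    R#T () (here refl)

    unique : Unique elements
    unique =
      Uniqueₚ.++⁺ (Uniqueₚ.map⁺ (λ { refl → refl }) (list-∖-unique _ P.unique))
        (Uniqueₚ.++⁺ (Uniqueₚ.map⁺ (λ { refl → refl }) (list-∖-unique _ Q.unique))
          (Uniqueₚ.++⁺ (Uniqueₚ.map⁺ (λ { refl → refl }) (list-∖-unique _ R.unique))
            (All.[] AllPairs.∷ AllPairs.[])
            (λ (x∈ , y∈) → R#T (tag-map inR (λ _ → refl) x∈) y∈))
          (λ (x∈ , y∈) → Q#R (tag-map inQ (λ _ → refl) x∈) (tag-R y∈)))
        (λ (x∈ , y∈) → P#Q (tag-map inP (λ _ → refl) x∈) (tag-Q y∈))

  Gl : RankedPoset
  Gl = record
    { Carrier           = Element
    ; _≤_               = _≤_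
    ; isDecPartialOrder = record
      { isPartialOrder = record
        { isPreorder = record
          { isEquivalence = isEquivalence
          ; reflexive     = ≤-reflexive
          ; trans         = λ {x} {y} {w} → ≤-trans {x} {y} {w}
          }
        ; antisym = ≤-antisym
        }
      ; _≟_  = _≟_
      ; _≤?_ = _≤?_
      }
    ; elements = elements
    ; complete = complete
    ; unique   = unique
    ; rank     = rank
    }

{-# OPTIONS --safe #-}

-- Split the sum of Möbius values of each poset into rows indexed by the lower
-- element.  The Möbius function of the glued poset agrees with that of P, Q or
-- R on intervals below the new top.  For r in the R-part, the sum of μ over
-- [r , 1̂] is zero in each of P, Q, R and the glued poset; comparing these sums
-- gives μ[r , 1̂] = μ_P[φP r , 1P] + μ_Q[φQ r , 1Q] + μ_R[r , 1R].  The last term now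
-- carries one more power of z than it does in ℳ R, and these terms add up to
-- g, whence the correction (1 - z) g.  The only geometric inputs are that the
-- rank of a face poset is strictly monotone and that its top has the dimension
-- of the polytope, so that the glued facets are coatoms.

module Submission where

open import Defs
open import Level using (Level; 0ℓ)
import Algebra.Properties.Ring as RingProperties
import Algebra.Properties.Semiring.Sum as SemiringSum
open import Data.Fin.Base using (Fin; zero; suc)
open import Data.Fin.Properties using (¬∀⟶∃¬)
import Data.Fin.Subset as Subset
open import Data.Fin.Subset.Properties using (_∈?_; ∉⊥; ∈⊤)
open import Data.Integer.Base as ℤ using (ℤ; +_; _+_; _-_; _*_; -_; 0ℤ; 1ℤ; -1ℤ; ∣_∣)
import Data.Integer.Properties as ℤₚ
open import Data.Integer.Tactic.RingSolver using (solve-∀)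
open import Data.List.Base using (List; []; _∷_; _++_; map; filter)
open import Data.List.Membership.Propositional using (_∈_)
open import Data.List.Membership.Propositional.Properties
  using (∈-map⁺; ∈-map⁻; ∈-++⁺ˡ; ∈-++⁺ʳ; ∈-filter⁺; ∈-filter⁻)
open import Data.List.Membership.Propositional.Properties.WithK using (unique∧set⇒bag)
open import Data.List.Properties using (filter-≐)
open import Data.List.Relation.Binary.BagAndSetEquality using (∼bag⇒↭)
open import Data.List.Relation.Binary.Permutation.Propositional as Perm using (_↭_)
import Data.List.Relation.Unary.All as All
import Data.List.Relation.Unary.AllPairs as AllPairs
open import Data.List.Relation.Unary.Any using (here; there)
open import Data.List.Relation.Unary.Unique.Propositional using (Unique)
import Data.List.Relation.Unary.Unique.Propositional.Properties as Uniqueₚ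
open import Data.Nat.Base as ℕ using (ℕ; zero; suc)
import Data.Nat.Properties as ℕₚ
open import Data.Product.Base using (∃-syntax; _×_; _,_; proj₁; proj₂)
open import Data.Sum.Base using (_⊎_; inj₁; inj₂; [_,_]′)
open import Data.Unit.Base using (tt)
open import Function.Base using (_∘_; id)
open import Function.Bundles using (_⇔_; mk⇔; Equivalence)
open import Function.Definitions using (Injective)
open import Induction.WellFounded using (Acc; acc)
open import Relation.Binary.Definitions using (Maximum)
open import Relation.Binary.Morphism.Structures using (IsOrderIsomorphism)
open import Relation.Binary.PropositionalEquality
  using (_≡_; _≢_; refl; sym; trans; cong; cong₂; subst; subst₂; module ≡-Reasoning)
import Relation.Binary.Reasoning.Setoid as ≈-Reasoning
open import Relation.Binary.Structures using (IsTotalOrder)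
open import Relation.Nullary using (¬_; Dec; yes; no; contradiction)
open import Relation.Nullary.Decidable using (_×-dec_; _→-dec_)
open import Relation.Unary using (Pred; Decidable; _∪_; ｛_｝)
open import Relation.Unary.Properties using (_∪?_)

open Equivalence using (to; from)

-- Dimensions of faces

-- A value of the Möbius function depends only on the interval below its second argument. Deleting
-- `F` and the top from `P` leaves a lower set, and the same set is a lower set of the glued poset,
-- so Möbius values are shared there. This is what forces `F` to be a coatom: another element above
-- `F`, other than the top, would have `F` in its lower intervals in `P` but not after gluing.
-- Values at the new top are outside this argument and must be solved for from vanishing sums. The
-- comparison of these sums works because, for `r` in the R-part, the interval from `φ r` to `F` is
-- a copy of the interval from `r` to `1R` and already sums to zero. Hence the outer elements of `P`
-- together with `1P` sum to zero on their own, likewise those of `Q`, and the sum in the glued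
-- poset splits into these partial sums and the one of `R`, with a single common last term.

+1-cancel-≤ : ∀ x y → x + 1ℤ ℤ.≤ y + 1ℤ → x ℤ.≤ y
+1-cancel-≤ x y x≤y = subst₂ ℤ._≤_ (undo x) (undo y) (ℤₚ.+-monoˡ-≤ -1ℤ x≤y)
  where
  undo : ∀ x → x + 1ℤ + -1ℤ ≡ x
  undo x = trans (ℤₚ.+-assoc x 1ℤ -1ℤ) (ℤₚ.+-identityʳ x)

+1-cancel-< : ∀ x y → x + 1ℤ ℤ.< y + 1ℤ → x ℤ.< y
+1-cancel-< x y x<y = ℤₚ.≰⇒> (λ y≤x → ℤₚ.<⇒≱ x<y (ℤₚ.+-monoˡ-≤ 1ℤ y≤x))

module Dimension {c ℓ₁ ℓ₂ : Level} (K : OrderedField c ℓ₁ ℓ₂) where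
  open OrderedField K hiding (zero)
    renaming ( _+_ to _⊕_; _*_ to _⊛_; _-_ to _⊝_; -_ to ⊝_
             ; refl to ≈-refl; sym to ≈-sym; trans to ≈-trans)
  open Convex K
  open SemiringSum semiring
  open RingProperties ring using (x∙y⁻¹≈ε⇒x≈y)
  open IsTotalOrder isTotalOrder using (antisym)
    renaming (trans to ≤-trans; reflexive to ≤-reflexive; ≤-respˡ-≈ to respˡ; ≤-respʳ-≈ to respʳ)
  open ≈-Reasoning setoid

  combination-· : ∀ {n m} (a : Point n) (w : Fin m → Carrier) (v : Fin m → Point n) →
                  a · combination w v ≈ sum λ i → w i ⊛ (a · v i)
  combination-· a w v = begin
    (sum λ j → a j ⊛ sum λ i → w i ⊛ v i j)      ≈⟨ sum-cong-≋ (λ j → *-distribˡ-sum (a j) (λ i → w i ⊛ v i j)) ⟩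
    (sum λ j → sum λ i → a j ⊛ (w i ⊛ v i j))    ≈⟨ ∑-comm (λ j i → a j ⊛ (w i ⊛ v i j)) ⟩
    (sum λ i → sum λ j → a j ⊛ (w i ⊛ v i j))    ≈⟨ sum-cong-≋ (λ i → sum-cong-≋ λ j → exchange (a j) (w i) (v i j)) ⟩
    (sum λ i → sum λ j → w i ⊛ (a j ⊛ v i j))    ≈⟨ sum-cong-≋ (λ i → ≈-sym (*-distribˡ-sum (w i) (λ j → a j ⊛ v i j))) ⟩
    (sum λ i → w i ⊛ (a · v i))                  ∎
    where
    exchange : ∀ x y t → x ⊛ (y ⊛ t) ≈ y ⊛ (x ⊛ t)
    exchange x y t = ≈-trans (≈-sym (*-assoc x y t)) (≈-trans (*-congʳ (*-comm x y)) (*-assoc y x t))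

  ·-cong : ∀ {n} (a : Point n) {x y : Point n} → x ≋ y → a · x ≈ a · y
  ·-cong a x≋y = sum-cong-≋ λ j → *-congˡ (x≋y j)

  0·≈0 : ∀ {n} (x : Point n) → (λ _ → 0#) · x ≈ 0#
  0·≈0 {n} x = ≈-trans (sum-cong-≋ λ j → zeroˡ (x j)) (sum-replicate-zero n)

  ·0≈0 : ∀ {n} (a : Point n) → a · (λ _ → 0#) ≈ 0#
  ·0≈0 {n} a = ≈-trans (sum-cong-≋ λ j → zeroʳ (a j)) (sum-replicate-zero n)

  sum-zero : ∀ {m} (t : Fin m → Carrier) → (∀ i → t i ≈ 0#) → sum t ≈ 0#
  sum-zero {m} t e = ≈-trans (sum-cong-≋ e) (sum-replicate-zero m)

  -- The slack of an inequality a · x ≤ b is affine in x.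
  slack-combination : ∀ {n m} (a : Point n) b (w : Fin m → Carrier) (v : Fin m → Point n) →
                      (sum λ i → w i ⊛ (b ⊝ a · v i)) ⊕ a · combination w v ≈ sum w ⊛ b
  slack-combination a b w v = begin
    (sum λ i → w i ⊛ (b ⊝ a · v i)) ⊕ a · combination w v                 ≈⟨ +-congˡ (combination-· a w v) ⟩
    (sum λ i → w i ⊛ (b ⊝ a · v i)) ⊕ (sum λ i → w i ⊛ (a · v i))        ≈⟨ ∑-distrib-+ (λ i → w i ⊛ (b ⊝ a · v i)) (λ i → w i ⊛ (a · v i)) ⟨
    (sum λ i → w i ⊛ (b ⊝ a · v i) ⊕ w i ⊛ (a · v i))                    ≈⟨ sum-cong-≋ (λ i → ≈-sym (distribˡ (w i) _ _)) ⟩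
    (sum λ i → w i ⊛ ((b ⊝ a · v i) ⊕ a · v i))                          ≈⟨ sum-cong-≋ (λ i → *-congˡ {w i} (cancel (a · v i))) ⟩
    (sum λ i → w i ⊛ b)                                                  ≈⟨ *-distribʳ-sum b w ⟨
    sum w ⊛ b                                                            ∎
    where
    cancel : ∀ x → (b ⊝ x) ⊕ x ≈ b
    cancel x = ≈-trans (+-assoc b (⊝ x) x) (≈-trans (+-congˡ (-‿inverseˡ x)) (+-identityʳ b))

  *-cancel-≉0 : ∀ {x y} → x ⊛ y ≈ 0# → ¬ y ≈ 0# → x ≈ 0#
  *-cancel-≉0 {x} {y} xy≈0 y≉0 with y⁻¹ , yy⁻¹≈1 ← inverse y y≉0 = begin
    x                 ≈⟨ *-identityʳ x ⟨
    x ⊛ 1#            ≈⟨ *-congˡ yy⁻¹≈1 ⟨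
    x ⊛ (y ⊛ y⁻¹)     ≈⟨ *-assoc x y y⁻¹ ⟨
    x ⊛ y ⊛ y⁻¹       ≈⟨ *-congʳ xy≈0 ⟩
    0# ⊛ y⁻¹          ≈⟨ zeroˡ y⁻¹ ⟩
    0#                ∎

  ≤⇒0≤- : ∀ {x y} → x ≤ y → 0# ≤ y ⊝ x
  ≤⇒0≤- {x} {y} x≤y = respˡ (-‿inverseˡ x) (respʳ (+-comm (⊝ x) y) (+-monoʳ-≤ (⊝ x) x≤y))

  +-nonNeg : ∀ {x y} → 0# ≤ x → 0# ≤ y → 0# ≤ x ⊕ y
  +-nonNeg {x} {y} 0≤x 0≤y = ≤-trans 0≤x (respˡ (+-identityʳ x) (+-monoʳ-≤ x 0≤y))

  sum-nonNeg : ∀ {m} (t : Fin m → Carrier) → (∀ i → 0# ≤ t i) → 0# ≤ sum t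
  sum-nonNeg {zero}  t 0≤t = ≤-reflexive ≈-refl
  sum-nonNeg {suc m} t 0≤t = +-nonNeg (0≤t zero) (sum-nonNeg (t ∘ suc) (0≤t ∘ suc))

  +≈0⇒≈0 : ∀ {x y} → 0# ≤ x → 0# ≤ y → x ⊕ y ≈ 0# → x ≈ 0#
  +≈0⇒≈0 {x} 0≤x 0≤y e = antisym (respʳ e (respˡ (+-identityʳ x) (+-monoʳ-≤ x 0≤y))) 0≤x

  sum≈0⇒≈0 : ∀ {m} (t : Fin m → Carrier) → (∀ i → 0# ≤ t i) → sum t ≈ 0# → ∀ i → t i ≈ 0#
  sum≈0⇒≈0 t 0≤t e zero    = +≈0⇒≈0 (0≤t zero) (sum-nonNeg (t ∘ suc) (0≤t ∘ suc)) e
  sum≈0⇒≈0 t 0≤t e (suc i) = sum≈0⇒≈0 (t ∘ suc) (0≤t ∘ suc)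
    (+≈0⇒≈0 (sum-nonNeg (t ∘ suc) (0≤t ∘ suc)) (0≤t zero) (≈-trans (+-comm _ _) e)) i

  module _ {n ℓ} (S : Point n → Set ℓ) where

    independent-pred : ∀ {k} → IndependentFamily S (suc k) → IndependentFamily S k
    independent-pred {k} (x , x∈ , indep) = x ∘ suc , x∈ ∘ suc , λ w sum≈0 comb≈0 i →
      indep (extend w) (≈-trans (+-identityˡ _) sum≈0)
            (λ j → ≈-trans (+-cong (zeroˡ _) (comb≈0 j)) (+-identityˡ _)) (suc i)
      where
      extend : (Fin k → Carrier) → Fin (suc k) → Carrier
      extend w zero    = 0#
      extend w (suc i) = w i

    independent-≤ : ∀ {k m} → k ℕ.≤′ m → IndependentFamily S m → IndependentFamily S k
    independent-≤ ℕ.≤′-refl       fam = fam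
    independent-≤ (ℕ.≤′-step k≤m) fam = independent-≤ k≤m (independent-pred fam)

    independent⇒≤dim : ∀ {d k} → HasDimension S d → IndependentFamily S k → + k ℤ.≤ d + 1ℤ
    independent⇒≤dim {d} {k} (m , m≡ , _ , ¬fam) fam = subst (+ k ℤ.≤_) m≡
      (ℤ.+≤+ (ℕₚ.≮⇒≥ λ m<k → ¬fam (independent-≤ (ℕₚ.≤⇒≤′ m<k) fam)))

  dim-mono-≤ : ∀ {n ℓ ℓ′} (S : Point n → Set ℓ) (T : Point n → Set ℓ′) {d e} →
               (∀ x → S x → T x) → HasDimension S d → HasDimension T e → d ℤ.≤ e
  dim-mono-≤ S T {d} {e} S⊆T (k , k≡ , (x , x∈ , indep) , _) dimT =
    +1-cancel-≤ d e (subst (ℤ._≤ e + 1ℤ) k≡ (independent⇒≤dim T {e} dimT (x , (λ i → S⊆T (x i) (x∈ i)) , indep)))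

  dim-mono-< : ∀ {n ℓ ℓ′} (S : Point n → Set ℓ) (T : Point n → Set ℓ′) {d e} →
               (∀ {k} → IndependentFamily S k → IndependentFamily T (suc k)) →
               HasDimension S d → HasDimension T e → d ℤ.< e
  dim-mono-< S T {d} {e} extend (k , k≡ , fam , _) dimT =
    +1-cancel-< d e (ℤₚ.<-≤-trans (subst (ℤ._< + suc k) k≡ (ℤ.+<+ (ℕₚ.n<1+n k)))
                                      (independent⇒≤dim T {e} dimT (extend fam)))

  -- Inclusions between the faces of one polytope

  module Faces (Π : Polytope) where
    open Polytope Π using (#V; vertex; isVertex; IsVertexSetOf)

    -- No weights need be written down: `isVertex` provides a face consisting of `vertex i` alone,
    -- and points of a face lie in the hull by definition.
    vertex∈Conv : ∀ i → Conv vertex (vertex i)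
    vertex∈Conv i with Φ , iff ← isVertex i = proj₁ (from (iff (vertex i)) λ _ → ≈-refl)

    slack : Face vertex → Fin #V → Carrier
    slack Φ i = Face.offset Φ ⊝ Face.normal Φ · vertex i

    slack≈0⇒∈ : ∀ {S} (Φ : Face vertex) → IsVertexSetOf S Φ → ∀ i → slack Φ i ≈ 0# → i Subset.∈ S
    slack≈0⇒∈ Φ iff i e = from (iff i) (vertex∈Conv i , ≈-sym (x∙y⁻¹≈ε⇒x≈y _ _ e))

    ≈⇒slack≈0 : ∀ {x y} → y ≈ x → x ⊝ y ≈ 0#
    ≈⇒slack≈0 y≈x = ≈-trans (+-congʳ (≈-sym y≈x)) (-‿inverseʳ _)

    ∈⇒slack≈0 : ∀ {S} (Φ : Face vertex) → IsVertexSetOf S Φ → ∀ {i} → i Subset.∈ S → slack Φ i ≈ 0#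
    ∈⇒slack≈0 Φ iff {i} i∈ = ≈⇒slack≈0 (proj₂ (to (iff i) i∈))

    module _ {S T} (Φ Ψ : Face vertex) (S⟷Φ : IsVertexSetOf S Φ) (T⟷Ψ : IsVertexSetOf T Ψ)
             (S⊆T : S Subset.⊆ T) where

      -- A point of Φ is a convex combination in which only vertices of Φ have nonzero weight.
      face-⊆ : ∀ x → Face.points Φ x → Face.points Ψ x
      face-⊆ x (x∈@(w , 0≤w , sum≈1 , x≋) , onΦ) = x∈ , onΨ
        where
        -- Kept general in `a` and `b` because it serves twice: for `Φ` it shows that the weighted
        -- slacks cancel, and for `Ψ` it recovers the value at `x` from them.
        total : ∀ a b → (sum λ i → w i ⊛ (b ⊝ a · vertex i)) ⊕ a · x ≈ b
        total a b = begin
          (sum λ i → w i ⊛ (b ⊝ a · vertex i)) ⊕ a · x                        ≈⟨ +-congˡ (·-cong a x≋) ⟩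
          (sum λ i → w i ⊛ (b ⊝ a · vertex i)) ⊕ a · combination w vertex     ≈⟨ slack-combination a b w vertex ⟩
          sum w ⊛ b                                                           ≈⟨ *-congʳ sum≈1 ⟩
          1# ⊛ b                                                              ≈⟨ *-identityˡ b ⟩
          b                                                                   ∎

        +≈⇒≈0 : ∀ {y b} → y ⊕ b ≈ b → y ≈ 0#
        +≈⇒≈0 {y} {b} e = begin
          y                 ≈⟨ +-identityʳ y ⟨
          y ⊕ 0#            ≈⟨ +-congˡ (-‿inverseʳ b) ⟨
          y ⊕ (b ⊝ b)       ≈⟨ +-assoc y b (⊝ b) ⟨
          y ⊕ b ⊝ b         ≈⟨ +-congʳ e ⟩
          b ⊝ b             ≈⟨ -‿inverseʳ b ⟩
          0#                ∎

        -- As `x` lies on `Φ`, the weighted slacks add up to zero; being nonnegative, they vanish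
        -- one by one.
        slackΦ≈0 : ∀ i → w i ⊛ slack Φ i ≈ 0#
        slackΦ≈0 = sum≈0⇒≈0 (λ i → w i ⊛ slack Φ i)
          (λ i → *-nonNeg (0≤w i) (≤⇒0≤- (Face.valid Φ (vertex i) (vertex∈Conv i))))
          (+≈⇒≈0 (≈-trans (+-congˡ (≈-sym onΦ)) (total (Face.normal Φ) (Face.offset Φ))))

        -- A vertex in `S` is in `T` and has no slack for `Ψ`; a vertex outside `S` has nonzero
        -- slack for `Φ`, so its weight is zero.
        slackΨ≈0 : ∀ i → w i ⊛ slack Ψ i ≈ 0#
        slackΨ≈0 i with i ∈? S
        ... | yes i∈S = ≈-trans (*-congˡ (∈⇒slack≈0 Ψ T⟷Ψ (S⊆T i∈S))) (zeroʳ (w i))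
        ... | no  i∉S = ≈-trans (*-congʳ (*-cancel-≉0 (slackΦ≈0 i) (i∉S ∘ slack≈0⇒∈ Φ S⟷Φ i))) (zeroˡ _)

        onΨ : Face.normal Ψ · x ≈ Face.offset Ψ
        onΨ = begin
          Face.normal Ψ · x                                             ≈⟨ +-identityˡ _ ⟨
          0# ⊕ Face.normal Ψ · x                                        ≈⟨ +-congʳ (sum-zero (λ i → w i ⊛ slack Ψ i) slackΨ≈0) ⟨
          (sum λ i → w i ⊛ slack Ψ i) ⊕ Face.normal Ψ · x               ≈⟨ total (Face.normal Ψ) (Face.offset Ψ) ⟩
          Face.offset Ψ                                                 ∎

      -- The slack of `Φ` is affine, zero on the points of `Φ` and nonzero at the new point
      -- `vertex i`. Evaluated on an affine relation it forces the weight of `vertex i` to be zero,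
      -- and what remains is a relation among the old points.
      face-extend : ∀ {i} → i Subset.∈ T → ¬ i Subset.∈ S → ∀ {k} →
                    IndependentFamily (Face.points Φ) k → IndependentFamily (Face.points Ψ) (suc k)
      face-extend {i} i∈T i∉S {k} (x , x∈ , indep) = y , y∈ , y-indep
        where
        y : Fin (suc k) → Point _
        y zero    = vertex i
        y (suc j) = x j

        y∈ : ∀ j → Face.points Ψ (y j)
        y∈ zero    = to (T⟷Ψ i) i∈T
        y∈ (suc j) = face-⊆ (x j) (x∈ j)

        y-indep : AffinelyIndependent y
        y-indep w sum≈0 comb≈0 = all
          where
          a = Face.normal Φ
          b = Face.offset Φ

          w₀*slack≈0 : w zero ⊛ slack Φ i ≈ 0#
          w₀*slack≈0 = begin
            w zero ⊛ slack Φ i                                        ≈⟨ +-identityʳ _ ⟨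
            w zero ⊛ slack Φ i ⊕ 0#                                   ≈⟨ +-congˡ (sum-zero (λ j → w (suc j) ⊛ (b ⊝ a · x j))
                                                                           (λ j → ≈-trans (*-congˡ (≈⇒slack≈0 (proj₂ (x∈ j)))) (zeroʳ _))) ⟨
            (sum λ j → w j ⊛ (b ⊝ a · y j))                           ≈⟨ +-identityʳ _ ⟨
            (sum λ j → w j ⊛ (b ⊝ a · y j)) ⊕ 0#                      ≈⟨ +-congˡ (≈-trans (·-cong a comb≈0) (·0≈0 a)) ⟨
            (sum λ j → w j ⊛ (b ⊝ a · y j)) ⊕ a · combination w y     ≈⟨ slack-combination a b w y ⟩
            sum w ⊛ b                                                 ≈⟨ *-congʳ sum≈0 ⟩
            0# ⊛ b                                                    ≈⟨ zeroˡ b ⟩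
            0#                                                        ∎

          w₀≈0 : w zero ≈ 0#
          w₀≈0 = *-cancel-≉0 w₀*slack≈0 (i∉S ∘ slack≈0⇒∈ Φ S⟷Φ i)

          dropˡ : ∀ {u t} → u ≈ 0# → u ⊕ t ≈ 0# → t ≈ 0#
          dropˡ u≈0 e = ≈-trans (≈-sym (+-identityˡ _)) (≈-trans (+-congʳ (≈-sym u≈0)) e)

          all : ∀ j → w j ≈ 0#
          all zero    = w₀≈0
          all (suc j) = indep (w ∘ suc) (dropˡ w₀≈0 sum≈0)
            (λ l → dropˡ (≈-trans (*-congʳ w₀≈0) (zeroˡ _)) (comb≈0 l)) j

    -- The inequality 0 ≤ 0, through which the polytope is a face of itself.
    whole : Face vertex
    whole = record
      { normal = λ _ → 0#
      ; offset = 0#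
      ; valid  = λ x _ → ≤-reflexive (0·≈0 x)
      }

    -- A single vertex is already an affinely independent family. This covers the comparison with
    -- the empty face, whose rank is -1 by convention and not a dimension given by a `Face`.
    dim-nonNeg : ∀ {d} {T} (Ψ : Face vertex) → IsVertexSetOf T Ψ → ∀ {i} → i Subset.∈ T →
                 HasDimension (Face.points Ψ) d → -1ℤ ℤ.< d
    dim-nonNeg {d} Ψ T⟷Ψ {i} i∈T dim = +1-cancel-< -1ℤ d
      (ℤₚ.<-≤-trans (ℤ.+<+ (ℕₚ.n<1+n 0)) (independent⇒≤dim (Face.points Ψ) {d} dim singleton))
      where
      singleton : IndependentFamily (Face.points Ψ) 1
      singleton = (λ _ → vertex i) , (λ _ → to (T⟷Ψ i) i∈T) ,
                  λ { w sum≈0 _ zero → ≈-trans (≈-sym (+-identityʳ _)) sum≈0 }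

-- Ranks in a face poset

module FacePoset {c ℓ₁ ℓ₂ : Level} {K : OrderedField c ℓ₁ ℓ₂} {P : RankedPoset} {Π : Convex.Polytope K}
                 (isFP : IsFacePoset P Π) where
  open RankedPoset P
  open IsFacePoset isFP
  open Convex K
  open Dimension K
  open Faces Π
  open Polytope Π using (#V; vertex)

  -- Some vertex of `q` is missing from `p`, since otherwise antisymmetry would identify them;
  -- membership is decidable, so a finite search finds it. That vertex enlarges every independent
  -- family of the smaller face, or shows that `q` has dimension at least 0 when `p` is empty.
  rank-mono-< : ∀ {p q} → p < q → rank p ℤ.< rank q
  rank-mono-< {p} {q} (p≤q , p≢q) = cases new (isFace p) (isFace q)
    where
    new : ∃[ i ] ¬ (i Subset.∈ vertexSet q → i Subset.∈ vertexSet p)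
    new = ¬∀⟶∃¬ #V _ (λ i → (i ∈? vertexSet q) →-dec (i ∈? vertexSet p))
            (λ q⊆p → p≢q (antisym p≤q (from (≤⇔⊆ q p) λ {i} → q⊆p i)))

    cases : ∃[ i ] ¬ (i Subset.∈ vertexSet q → i Subset.∈ vertexSet p) → _ → _ → rank p ℤ.< rank q
    cases (i , new) cp cq with i ∈? vertexSet q | i ∈? vertexSet p
    ... | no i∉q  | _       = contradiction (λ i∈q → contradiction i∈q i∉q) new
    ... | yes _   | yes i∈p = contradiction (λ _ → i∈p) new
    cases (i , _) (inj₁ p≡⊥) (inj₂ (Ψ , q⟷Ψ)) | yes i∈q | no i∉p =
      subst (ℤ._< rank q) (sym (rank-∅ p p≡⊥)) (dim-nonNeg Ψ q⟷Ψ i∈q (rank-dim q Ψ q⟷Ψ))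
    cases (i , _) (inj₂ (Φ , p⟷Φ)) (inj₂ (Ψ , q⟷Ψ)) | yes i∈q | no i∉p =
      dim-mono-< (Face.points Φ) (Face.points Ψ)
        (face-extend Φ Ψ p⟷Φ q⟷Ψ (to (≤⇔⊆ p q) p≤q) i∈q i∉p) (rank-dim p Φ p⟷Φ) (rank-dim q Ψ q⟷Ψ)
    cases (i , _) _ (inj₁ q≡⊥) | yes i∈q | no i∉p = contradiction (subst (i Subset.∈_) q≡⊥ i∈q) ∉⊥

  -- The face `whole` occurs in the poset with all vertices, and `t` lies above it. So `t` has the
  -- vertex set of `whole`, whose points are exactly those of the polytope.
  rank-maximum : ∀ {t d} → Maximum _≤_ t → HasDimension (Polytope.points Π) d → rank t ≡ d
  rank-maximum {t} max dim = ℤₚ.≤-antisym (dim-mono-≤ (Face.points whole) (Polytope.points Π) (λ _ → proj₁) dim-t dim)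
                                          (dim-mono-≤ (Polytope.points Π) (Face.points whole) (λ x x∈ → x∈ , 0·≈0 x) dim dim-t)
    where
    full : ∀ i → i Subset.∈ vertexSet t
    full i with p , p≡⊤ ← hasFaces Subset.⊤ whole (λ i → mk⇔ (λ _ → vertex∈Conv i , 0·≈0 (vertex i)) (λ _ → ∈⊤)) =
      to (≤⇔⊆ p t) (max p) (subst (i Subset.∈_) (sym p≡⊤) ∈⊤)

    dim-t : HasDimension (Face.points whole) (rank t)
    dim-t = rank-dim t whole (λ i → mk⇔ (λ _ → vertex∈Conv i , 0·≈0 (vertex i)) (λ _ → full i))

-- Finite integer sums

module _ {A : Set} where

  ∑-cong : (xs : List A) {f h : A → ℤ} → (∀ x → f x ≡ h x) → ∑ℤ xs f ≡ ∑ℤ xs h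
  ∑-cong []       e = refl
  ∑-cong (x ∷ xs) e = cong₂ _+_ (e x) (∑-cong xs e)

  ∑-zero : (xs : List A) {f : A → ℤ} → (∀ x → f x ≡ 0ℤ) → ∑ℤ xs f ≡ 0ℤ
  ∑-zero []       e = refl
  ∑-zero (x ∷ xs) e = cong₂ _+_ (e x) (∑-zero xs e)

  ∑-distrib-+ : (xs : List A) (f h : A → ℤ) →
                ∑ℤ xs (λ x → f x + h x) ≡ ∑ℤ xs f + ∑ℤ xs h
  ∑-distrib-+ []       f h = refl
  ∑-distrib-+ (x ∷ xs) f h = trans (cong (λ n → f x + h x + n) (∑-distrib-+ xs f h))
                                   (interchange (f x) (h x) _ _)
    where
    interchange : ∀ a b c e → a + b + (c + e) ≡ a + c + (b + e)
    interchange = solve-∀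

  ∑-++ : (xs ys : List A) (f : A → ℤ) → ∑ℤ (xs ++ ys) f ≡ ∑ℤ xs f + ∑ℤ ys f
  ∑-++ []       ys f = sym (ℤₚ.+-identityˡ _)
  ∑-++ (x ∷ xs) ys f = trans (cong (λ n → f x + n) (∑-++ xs ys f)) (sym (ℤₚ.+-assoc (f x) _ _))

  ∑-map : ∀ {B : Set} (e : B → A) (xs : List B) (f : A → ℤ) → ∑ℤ (map e xs) f ≡ ∑ℤ xs (f ∘ e)
  ∑-map e []       f = refl
  ∑-map e (x ∷ xs) f = cong (λ n → f (e x) + n) (∑-map e xs f)

  ∑-↭ : ∀ {xs ys : List A} (f : A → ℤ) → xs ↭ ys → ∑ℤ xs f ≡ ∑ℤ ys f
  ∑-↭ f Perm.refl         = refl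
  ∑-↭ f (Perm.prep x p)   = cong (λ n → f x + n) (∑-↭ f p)
  ∑-↭ f (Perm.swap x y p) = trans (cong (λ n → f x + (f y + n)) (∑-↭ f p)) (exchange (f x) (f y) _)
    where
    exchange : ∀ a b c → a + (b + c) ≡ b + (a + c)
    exchange = solve-∀
  ∑-↭ f (Perm.trans p q)  = trans (∑-↭ f p) (∑-↭ f q)

  -- Duplicate-free lists with the same members are permutations of each other, so an enumeration of
  -- a poset can be regrouped without regard to its order.
  ∑-unique : ∀ {xs ys : List A} (f : A → ℤ) → Unique xs → Unique ys →
             (∀ {x} → x ∈ xs → x ∈ ys) → (∀ {x} → x ∈ ys → x ∈ xs) → ∑ℤ xs f ≡ ∑ℤ ys f
  ∑-unique f uxs uys i j = ∑-↭ f (∼bag⇒↭ (unique∧set⇒bag uxs uys (mk⇔ i j)))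

  -- Since `μ` vanishes off the order, this turns sums over upper intervals into sums over the whole
  -- poset, which are easier to regroup.
  ∑-filter : ∀ {D : Pred A 0ℓ} (D? : Decidable D) (xs : List A) {f : A → ℤ} →
             (∀ x → ¬ D x → f x ≡ 0ℤ) → ∑ℤ (filter D? xs) f ≡ ∑ℤ xs f
  ∑-filter D? []       e = refl
  ∑-filter D? (x ∷ xs) {f} e with D? x
  ... | yes _ = cong (λ n → f x + n) (∑-filter D? xs e)
  ... | no ¬D = trans (∑-filter D? xs e)
                      (sym (trans (cong (_+ ∑ℤ xs f) (e x ¬D)) (ℤₚ.+-identityˡ _)))

-- Coefficients

coeff-+ : ∀ f h k → coeff (f +ₚ h) k ≡ coeff f k + coeff h k
coeff-+ []      h       k       = sym (ℤₚ.+-identityˡ _)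
coeff-+ (a ∷ f) []      k       = sym (ℤₚ.+-identityʳ _)
coeff-+ (a ∷ f) (b ∷ h) zero    = refl
coeff-+ (a ∷ f) (b ∷ h) (suc k) = coeff-+ f h k

coeff-• : ∀ a f k → coeff (a • f) k ≡ a * coeff f k
coeff-• a []      k       = sym (ℤₚ.*-zeroʳ a)
coeff-• a (b ∷ f) zero    = refl
coeff-• a (b ∷ f) (suc k) = coeff-• a f k

coeff-- : ∀ f h k → coeff (f -ₚ h) k ≡ coeff f k - coeff h k
coeff-- f h k = begin
  coeff (f -ₚ h) k                    ≡⟨ coeff-+ f (-1ℤ • h) k ⟩
  coeff f k + coeff (-1ℤ • h) k     ≡⟨ cong (λ n → coeff f k + n) (coeff-• -1ℤ h k) ⟩
  coeff f k + -1ℤ * coeff h k     ≡⟨ cong (λ n → coeff f k + n) (ℤₚ.-1*i≡-i (coeff h k)) ⟩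
  coeff f k - coeff h k               ∎
  where open ≡-Reasoning

coeff-∑ : ∀ {A : Set} (xs : List A) f k → coeff (∑ₚ xs f) k ≡ ∑ℤ xs (λ x → coeff (f x) k)
coeff-∑ []       f k = refl
coeff-∑ (x ∷ xs) f k = trans (coeff-+ (f x) _ k) (cong (λ n → coeff (f x) k + n) (coeff-∑ xs f k))

-- Here 1ₚ -ₚ z computes to 1ℤ ∷ -1ℤ ∷ [].
coeff-[1-z]* : ∀ f k → coeff ((1ₚ -ₚ z) *ₚ f) k ≡ coeff f k - coeff (0ℤ ∷ f) k
coeff-[1-z]* f k = begin
  coeff (1ℤ • f +ₚ (0ℤ ∷ (-1ℤ • f +ₚ (0ℤ ∷ [])))) k                ≡⟨ coeff-+ (1ℤ • f) _ k ⟩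
  coeff (1ℤ • f) k + coeff (0ℤ ∷ (-1ℤ • f +ₚ (0ℤ ∷ []))) k       ≡⟨ cong₂ _+_ (trans (coeff-• 1ℤ f k) (ℤₚ.*-identityˡ _)) (shift k) ⟩
  coeff f k - coeff (0ℤ ∷ f) k                                     ∎
  where
  open ≡-Reasoning
  zeros : ∀ k → coeff (0ℤ ∷ []) k ≡ 0ℤ
  zeros zero    = refl
  zeros (suc k) = refl
  shift : ∀ k → coeff (0ℤ ∷ (-1ℤ • f +ₚ (0ℤ ∷ []))) k ≡ - coeff (0ℤ ∷ f) k
  shift zero    = refl
  shift (suc k) = begin
    coeff (-1ℤ • f +ₚ (0ℤ ∷ [])) k              ≡⟨ coeff-+ (-1ℤ • f) _ k ⟩
    coeff (-1ℤ • f) k + coeff (0ℤ ∷ []) k     ≡⟨ cong₂ _+_ (coeff-• -1ℤ f k) (zeros k) ⟩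
    -1ℤ * coeff f k + 0ℤ                    ≡⟨ ℤₚ.+-identityʳ _ ⟩
    -1ℤ * coeff f k                           ≡⟨ ℤₚ.-1*i≡-i _ ⟩
    - coeff f k                               ∎

-- Möbius functions

module MöbiusProperties (X : RankedPoset) where
  open RankedPoset X
  open Möbius X

  -- Fixing the exponent `k` turns the polynomial identity into one between integer sums, which the
  -- ring solver can finish.
  ⟪_⟫ : ℕ → Carrier → Carrier → ℤ
  ⟪ k ⟫ p q = coeff (μ-z p q) k

  ⟪⟫-μ : ∀ k p q → ⟪ k ⟫ p q ≡ μ p q * coeff (z^ ∣ rank q - rank p ∣) k
  ⟪⟫-μ k p q = coeff-• (μ p q) (z^ ∣ rank q - rank p ∣) k

  ⟪⟫-≰ : ∀ k p q → ¬ p ≤ q → ⟪ k ⟫ p q ≡ 0ℤ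
  ⟪⟫-≰ k p q p≰q = trans (⟪⟫-μ k p q) (cong (_* coeff (z^ ∣ rank q - rank p ∣) k) (μ-≰ p q p≰q))

  ⟪⟫-refl : ∀ k p → ⟪ k ⟫ p p ≡ coeff 1ₚ k
  ⟪⟫-refl k p = begin
    ⟪ k ⟫ p p                                     ≡⟨ ⟪⟫-μ k p p ⟩
    μ p p * coeff (z^ ∣ rank p - rank p ∣) k    ≡⟨ cong₂ (λ n m → n * coeff (z^ ∣ m ∣) k) (μ-refl p) (ℤₚ.+-inverseʳ (rank p)) ⟩
    1ℤ * coeff 1ₚ k                             ≡⟨ ℤₚ.*-identityˡ _ ⟩
    coeff 1ₚ k                                    ∎
    where open ≡-Reasoning

  coeff-ℳ : ∀ k → coeff (ℳ X) k ≡ ∑ℤ elements (λ p → ∑ℤ elements (⟪ k ⟫ p))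
  coeff-ℳ k = trans (coeff-∑ elements _ k) (∑-cong elements λ p →
    trans (coeff-∑ (filter (p ≤?_) elements) _ k) (∑-filter (p ≤?_) elements (⟪⟫-≰ k p)))

  -- The defining recursion at `t` with both sides collected: as `t` is the maximum, the elements
  -- above `p` are `t` and the half-open interval below it.
  ∑μ≡0 : ∀ {t} → Maximum _≤_ t → ∀ p → p ≢ t → ∑ℤ elements (μ p) ≡ 0ℤ
  ∑μ≡0 {t} max p p≢t = begin
    ∑ℤ elements (μ p)                                     ≡⟨ ∑-filter (p ≤?_) elements (μ-≰ p) ⟨
    ∑ℤ (filter (p ≤?_) elements) (μ p)                    ≡⟨ ∑-unique (μ p) (Uniqueₚ.filter⁺ (p ≤?_) unique)
                                                               (All.tabulate t∉ AllPairs.∷ Uniqueₚ.filter⁺ [ p , t ⟩? unique) split join ⟩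
    μ p t + ∑ℤ (filter [ p , t ⟩? elements) (μ p)       ≡⟨ cong (_+ ∑ℤ (filter [ p , t ⟩? elements) (μ p)) (μ-< p t (max p , p≢t)) ⟩
    - ∑ℤ (filter [ p , t ⟩? elements) (μ p)
      + ∑ℤ (filter [ p , t ⟩? elements) (μ p)           ≡⟨ ℤₚ.+-inverseˡ (∑ℤ (filter [ p , t ⟩? elements) (μ p)) ⟩
    0ℤ                                                    ∎
    where
    open ≡-Reasoning
    t∉ : ∀ {x} → x ∈ filter [ p , t ⟩? elements → t ≢ x
    t∉ x∈ refl = proj₂ (proj₂ (proj₂ (∈-filter⁻ [ p , t ⟩? {xs = elements} x∈))) refl
    split : ∀ {x} → x ∈ filter (p ≤?_) elements → x ∈ t ∷ filter [ p , t ⟩? elements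
    split {x} x∈ with x ≟ t
    ... | yes refl = here refl
    ... | no x≢t   = there (∈-filter⁺ [ p , t ⟩? (complete x)
                       (proj₂ (∈-filter⁻ (p ≤?_) {xs = elements} x∈) , max x , x≢t))
    join : ∀ {x} → x ∈ t ∷ filter [ p , t ⟩? elements → x ∈ filter (p ≤?_) elements
    join (here refl) = ∈-filter⁺ (p ≤?_) (complete t) (max p)
    join {x} (there x∈) = ∈-filter⁺ (p ≤?_) (complete x) (proj₁ (proj₂ (∈-filter⁻ [ p , t ⟩? {xs = elements} x∈)))

module _ (X Y : RankedPoset) where
  private
    module X = RankedPoset X
    module Y = RankedPoset Y
    open Möbius

  -- X and Y share a lower set, presented by its two inclusions f and g.
  μ-lowerSet : {I : Set} (is : List I) → (∀ i → i ∈ is) → Unique is →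
               (f : I → X.Carrier) (g : I → Y.Carrier) →
               Injective _≡_ _≡_ f → Injective _≡_ _≡_ g →
               (∀ i j → f i X.≤ f j ⇔ g i Y.≤ g j) →
               (∀ x j → x X.≤ f j → ∃[ i ] x ≡ f i) →
               (∀ y j → y Y.≤ g j → ∃[ i ] y ≡ g i) →
               ∀ i j → μ X (f i) (f j) ≡ μ Y (g i) (g j)
  μ-lowerSet {I} is all∈ uis f g f-inj g-inj f⇔g f-lower g-lower i j = go j (X.<-wellFounded (f j))
    where
    <⇔ : ∀ i j → f i X.< f j ⇔ g i Y.< g j
    <⇔ i j = mk⇔ (λ (i≤j , i≢j) → to (f⇔g i j) i≤j , i≢j ∘ cong f ∘ g-inj)
                 (λ (i≤j , i≢j) → from (f⇔g i j) i≤j , i≢j ∘ cong g ∘ f-inj)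

    -- Everything in the half-open interval is below `e j`, hence in the image of `e`, so the sum
    -- can be indexed by `I`.
    restrict : ∀ (Z : RankedPoset) (e : I → RankedPoset.Carrier Z) (let module Z = RankedPoset Z) →
               Injective _≡_ _≡_ e → (∀ z j → z Z.≤ e j → ∃[ i ] z ≡ e i) → ∀ p j h →
               ∑ℤ (filter Z.[ p , e j ⟩? Z.elements) h ≡ ∑ℤ (filter (λ i → Z.[ p , e j ⟩? (e i)) is) (h ∘ e)
    restrict Z e e-inj lower p j h = trans
      (∑-unique h (Uniqueₚ.filter⁺ Z.[ p , e j ⟩? Z.unique)
        (Uniqueₚ.map⁺ e-inj (Uniqueₚ.filter⁺ (λ i → Z.[ p , e j ⟩? (e i)) uis)) ⊆ ⊇)
      (∑-map e (filter (λ i → Z.[ p , e j ⟩? (e i)) is) h)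
      where
      module Z = RankedPoset Z
      ⊆ : ∀ {z} → z ∈ filter Z.[ p , e j ⟩? Z.elements → z ∈ map e (filter (λ i → Z.[ p , e j ⟩? (e i)) is)
      ⊆ {z} z∈ with proj₂ (∈-filter⁻ Z.[ p , e j ⟩? {xs = Z.elements} z∈)
      ... | p≤z , z<j with lower z j (proj₁ z<j)
      ... | i , refl = ∈-map⁺ e (∈-filter⁺ (λ i → Z.[ p , e j ⟩? (e i)) (all∈ i) (p≤z , z<j))
      ⊇ : ∀ {z} → z ∈ map e (filter (λ i → Z.[ p , e j ⟩? (e i)) is) → z ∈ filter Z.[ p , e j ⟩? Z.elements
      ⊇ z∈ with ∈-map⁻ e z∈
      ... | i , i∈ , refl = ∈-filter⁺ Z.[ p , e j ⟩? (Z.complete (e i))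
                              (proj₂ (∈-filter⁻ (λ i → Z.[ p , e j ⟩? (e i)) {xs = is} i∈))

    -- Unlike `∑-cong`, this passes the filtering condition on to the comparison of terms. In `go`
    -- that condition contains `f k < f j`, the descent that justifies the recursive call.
    ∑-cong-filter : ∀ {D : Pred I 0ℓ} (D? : Decidable D) (js : List I) {h h′ : I → ℤ} →
                    (∀ i → D i → h i ≡ h′ i) → ∑ℤ (filter D? js) h ≡ ∑ℤ (filter D? js) h′
    ∑-cong-filter D? []       e = refl
    ∑-cong-filter D? (k ∷ js) e with D? k
    ... | yes Dk = cong₂ _+_ (e k Dk) (∑-cong-filter D? js e)
    ... | no _   = ∑-cong-filter D? js e

    go : ∀ j → Acc X._<_ (f j) → μ X (f i) (f j) ≡ μ Y (g i) (g j)
    go j (acc rs) = byCases (f i X.≤? f j) (f i X.≟ f j)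
      where
      byCases : Dec (f i X.≤ f j) → Dec (f i ≡ f j) → μ X (f i) (f j) ≡ μ Y (g i) (g j)
      byCases (no i≰j) _ = trans (μ-≰ X (f i) (f j) i≰j) (sym (μ-≰ Y (g i) (g j) (i≰j ∘ from (f⇔g i j))))
      byCases (yes _) (yes fi≡fj) =
        subst (λ k → μ X (f k) (f j) ≡ μ Y (g k) (g j)) (sym (f-inj fi≡fj))
          (trans (μ-refl X (f j)) (sym (μ-refl Y (g j))))
      byCases (yes i≤j) (no i≢j) = begin
        μ X (f i) (f j)
          ≡⟨ μ-< X (f i) (f j) (i≤j , i≢j) ⟩
        - ∑ℤ (filter X.[ f i , f j ⟩? X.elements) (μ X (f i))
          ≡⟨ cong ℤ.-_ (restrict X f f-inj f-lower (f i) j (μ X (f i))) ⟩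
        - ∑ℤ (filter between-f? is) (μ X (f i) ∘ f)
          ≡⟨ cong ℤ.-_ (∑-cong-filter between-f? is (λ k k∈ → go k (rs (proj₂ k∈)))) ⟩
        - ∑ℤ (filter between-f? is) (μ Y (g i) ∘ g)
          ≡⟨ cong (λ l → - ∑ℤ l (μ Y (g i) ∘ g)) (filter-≐ between-f? between-g?
               ((λ {k} (i≤k , k<j) → to (f⇔g i k) i≤k , to (<⇔ k j) k<j) ,
                (λ {k} (i≤k , k<j) → from (f⇔g i k) i≤k , from (<⇔ k j) k<j)) is) ⟩
        - ∑ℤ (filter between-g? is) (μ Y (g i) ∘ g)
          ≡⟨ cong ℤ.-_ (restrict Y g g-inj g-lower (g i) j (μ Y (g i))) ⟨
        - ∑ℤ (filter Y.[ g i , g j ⟩? Y.elements) (μ Y (g i))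
          ≡⟨ μ-< Y (g i) (g j) (to (<⇔ i j) (i≤j , i≢j)) ⟨
        μ Y (g i) (g j) ∎
        where
        open ≡-Reasoning
        between-f? : Decidable (λ k → X.[ f i , f j ⟩ (f k))
        between-f? k = X.[ f i , f j ⟩? (f k)
        between-g? : Decidable (λ k → Y.[ g i , g j ⟩ (g k))
        between-g? k = Y.[ g i , g j ⟩? (g k)

i≡i-1+1 : ∀ i → i ≡ i - 1ℤ + 1ℤ
i≡i-1+1 = solve-∀

i+j≡0⇒j≡-i : ∀ i j → i + j ≡ 0ℤ → j ≡ - i
i+j≡0⇒j≡-i i j e = trans (isolate i j) (trans (cong (_- i) e) (ℤₚ.+-identityˡ (- i)))
  where
  isolate : ∀ i j → j ≡ i + j - i
  isolate = solve-∀

-- A face poset without its top, and the facet along which it is glued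

module BelowMaximum {R : RankedPoset} (boundsR : Bounded R) where
  open RankedPoset R
  open Bounded boundsR
  open MöbiusProperties R

  proper : List (Carrier ∖ ｛ 1̂ ｝)
  proper = list-∖ (1̂ ≟_) elements

  ∑-proper : ∀ h → ∑ℤ elements h ≡ ∑ℤ proper (h ∘ proj₁) + h 1̂
  ∑-proper h = begin
    ∑ℤ elements h                           ≡⟨ ∑-unique h unique uniqueʳ (λ {x} _ → ⊆ x) (λ {x} _ → complete x) ⟩
    ∑ℤ (map proj₁ proper ++ 1̂ ∷ []) h       ≡⟨ ∑-++ (map proj₁ proper) (1̂ ∷ []) h ⟩
    ∑ℤ (map proj₁ proper) h + (h 1̂ + 0ℤ)    ≡⟨ cong₂ _+_ (∑-map proj₁ proper h) (ℤₚ.+-identityʳ (h 1̂)) ⟩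
    ∑ℤ proper (h ∘ proj₁) + h 1̂             ∎
    where
    open ≡-Reasoning
    disjoint : ∀ {x} → ¬ (x ∈ map proj₁ proper × x ∈ 1̂ ∷ [])
    disjoint (x∈ , here refl) with ∈-map⁻ proj₁ x∈
    ... | (_ , ≢1) , _ , refl = ≢1 refl
    uniqueʳ : Unique (map proj₁ proper ++ 1̂ ∷ [])
    uniqueʳ = Uniqueₚ.++⁺ (Uniqueₚ.map⁺ ∖-≡ (list-∖-unique (1̂ ≟_) unique)) (All.[] AllPairs.∷ AllPairs.[]) disjoint
    ⊆ : ∀ x → x ∈ map proj₁ proper ++ 1̂ ∷ []
    ⊆ x with 1̂ ≟ x
    ... | yes refl = ∈-++⁺ʳ (map proj₁ proper) (here refl)
    ... | no 1≢x   = ∈-++⁺ˡ (∈-map⁺ proj₁ (list-∖-complete (1̂ ≟_) (x , 1≢x) (complete x)))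

  1≰ : ((r , _) : Carrier ∖ ｛ 1̂ ｝) → ¬ 1̂ ≤ r
  1≰ (r , 1≢r) 1≤r = 1≢r (antisym 1≤r (maximum r))

  ℳ-proper : ∀ k → coeff (ℳ R) k ≡
    ∑ℤ proper (λ (r , _) → ∑ℤ proper (λ (s , _) → ⟪ k ⟫ r s) + ⟪ k ⟫ r 1̂) + coeff 1ₚ k
  ℳ-proper k = begin
    coeff (ℳ R) k                                                       ≡⟨ coeff-ℳ k ⟩
    ∑ℤ elements (λ p → ∑ℤ elements (⟪ k ⟫ p))                           ≡⟨ ∑-proper (λ p → ∑ℤ elements (⟪ k ⟫ p)) ⟩
    ∑ℤ proper (λ (r , _) → ∑ℤ elements (⟪ k ⟫ r)) + ∑ℤ elements (⟪ k ⟫ 1̂)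
      ≡⟨ cong₂ _+_ (∑-cong proper (λ (r , _) → ∑-proper (⟪ k ⟫ r))) row-1̂ ⟩
    ∑ℤ proper (λ (r , _) → ∑ℤ proper (λ (s , _) → ⟪ k ⟫ r s) + ⟪ k ⟫ r 1̂) + coeff 1ₚ k ∎
    where
    open ≡-Reasoning
    row-1̂ : ∑ℤ elements (⟪ k ⟫ 1̂) ≡ coeff 1ₚ k
    row-1̂ = trans (∑-proper (⟪ k ⟫ 1̂)) (trans
      (cong₂ _+_ (∑-zero proper (λ s → ⟪⟫-≰ k 1̂ (proj₁ s) (1≰ s))) (⟪⟫-refl k 1̂)) (ℤₚ.+-identityˡ _))

  module _ (rank-< : ∀ {r} → r < 1̂ → rank r ℤ.< rank 1̂) where

    rank-≤ : ∀ r → rank r ℤ.≤ rank 1̂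
    rank-≤ r with r ≟ 1̂
    ... | yes refl = ℤₚ.≤-refl
    ... | no r≢1   = ℤₚ.<⇒≤ (rank-< (maximum r , r≢1))

    -- At the top rank the first condition of `g` holds for every `p`, and by strictness of the rank
    -- the second leaves only `1̂`. So `g` is the last column of `ℳ R`; `coeff 1ₚ k` is its diagonal
    -- entry.
    coeff-g : ∀ k → coeff (g R (rank 1̂)) k ≡ ∑ℤ proper (λ (r , _) → ⟪ k ⟫ r 1̂) + coeff 1ₚ k
    coeff-g k = begin
      coeff (g R (rank 1̂)) k                                ≡⟨ coeff-∑ (filter low? elements) _ k ⟩
      ∑ℤ (filter low? elements) row                         ≡⟨ ∑-filter low? elements {row} (λ p high → contradiction (rank-≤ p) high) ⟩
      ∑ℤ elements row                                       ≡⟨ ∑-cong elements row≡ ⟩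
      ∑ℤ elements (λ p → ⟪ k ⟫ p 1̂)                         ≡⟨ ∑-proper (λ p → ⟪ k ⟫ p 1̂) ⟩
      ∑ℤ proper (λ (r , _) → ⟪ k ⟫ r 1̂) + ⟪ k ⟫ 1̂ 1̂         ≡⟨ cong (_+_ (∑ℤ proper (λ (r , _) → ⟪ k ⟫ r 1̂))) (⟪⟫-refl k 1̂) ⟩
      ∑ℤ proper (λ (r , _) → ⟪ k ⟫ r 1̂) + coeff 1ₚ k        ∎
      where
      open ≡-Reasoning
      low? : Decidable (λ p → rank p ℤ.≤ rank 1̂)
      low? p = rank p ℤₚ.≤? rank 1̂
      high? : ∀ p → Decidable (λ q → p ≤ q × rank 1̂ ℤ.≤ rank q)
      high? p q = (p ≤? q) ×-dec (rank 1̂ ℤₚ.≤? rank q)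
      row : Carrier → ℤ
      row p = coeff (∑ₚ (filter (high? p) elements) (Möbius.μ-z R p)) k
      row≡ : ∀ p → row p ≡ ⟪ k ⟫ p 1̂
      row≡ p = trans (coeff-∑ (filter (high? p) elements) _ k) (trans
        (∑-unique (⟪ k ⟫ p) (Uniqueₚ.filter⁺ (high? p) unique) (All.[] AllPairs.∷ AllPairs.[]) ⊆ ⊇)
        (ℤₚ.+-identityʳ _))
        where
        ⊆ : ∀ {q} → q ∈ filter (high? p) elements → q ∈ 1̂ ∷ []
        ⊆ {q} q∈ with q ≟ 1̂ | ∈-filter⁻ (high? p) {xs = elements} q∈
        ... | yes q≡1 | _             = here q≡1
        ... | no q≢1  | _ , _ , 1≤q = contradiction 1≤q (ℤₚ.<⇒≱ (rank-< (maximum q , q≢1)))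
        ⊇ : ∀ {q} → q ∈ 1̂ ∷ [] → q ∈ filter (high? p) elements
        ⊇ (here refl) = ∈-filter⁺ (high? p) (complete 1̂) (maximum p , ℤₚ.≤-refl)

    -- Prepending `0ℤ` is multiplication by z. It accounts for the new top lying one rank above
    -- where the maximum of `R` was.
    ⟪⟫-shift : ∀ k r → coeff (0ℤ ∷ Möbius.μ-z R r 1̂) k ≡
               Möbius.μ R r 1̂ * coeff (z^ ∣ rank 1̂ + 1ℤ - rank r ∣) k
    ⟪⟫-shift k r = trans (shift k) (cong (λ n → Möbius.μ R r 1̂ * coeff (z^ n) k) (sym exponent))
      where
      m : ℕ
      m = ∣ rank 1̂ - rank r ∣
      -- Absolute value commutes with adding one only because the difference is nonnegative, which
      -- is where `rank-≤` enters.
      exponent : ∣ rank 1̂ + 1ℤ - rank r ∣ ≡ suc m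
      exponent = cong ∣_∣ (trans (rotate (rank 1̂) (rank r))
        (cong (_+_ 1ℤ) (sym (ℤₚ.0≤i⇒+∣i∣≡i (ℤₚ.i≤j⇒0≤j-i (rank-≤ r))))))
        where
        rotate : ∀ a b → a + 1ℤ - b ≡ 1ℤ + (a - b)
        rotate = solve-∀
      shift : ∀ k → coeff (0ℤ ∷ Möbius.μ-z R r 1̂) k ≡ Möbius.μ R r 1̂ * coeff (z^ suc m) k
      shift zero    = sym (ℤₚ.*-zeroʳ (Möbius.μ R r 1̂))
      shift (suc k) = ⟪⟫-μ k r 1̂

    coeff-0∷g : ∀ k → coeff (0ℤ ∷ g R (rank 1̂)) k ≡
                ∑ℤ proper (λ (r , _) → coeff (0ℤ ∷ Möbius.μ-z R r 1̂) k) + coeff z k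
    coeff-0∷g zero    = sym (trans (ℤₚ.+-identityʳ _) (∑-zero proper (λ _ → refl)))
    coeff-0∷g (suc k) = coeff-g k

module Facet
  {P R : RankedPoset} (boundsP : Bounded P) (boundsR : Bounded R)
  {F : RankedPoset.Carrier P} (iso : RankIso R P (Bounded.∅ boundsP) F)
  (coatom : ∀ {a} → RankedPoset._≤_ P F a → F ≡ a ⊎ Bounded.1̂ boundsP ≡ a)
  (rank-1̂ : RankedPoset.rank P (Bounded.1̂ boundsP) ≡ RankedPoset.rank P F + 1ℤ)
  where

  private
    module P = RankedPoset P
    module R = RankedPoset R
    open module Pᵇ = Bounded boundsP using (∅) renaming (1̂ to 1P)
    open module Rᵇ = Bounded boundsR using () renaming (1̂ to 1R)
    module P⟪⟫ = MöbiusProperties P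
    module R⟪⟫ = MöbiusProperties R
    μP = Möbius.μ P
    μR = Möbius.μ R
  open RankIso iso using (φ; φ-mono; φ-cancel; isOrderIsomorphism; rank-preserving) renaming (to to φ-to)
  open BelowMaximum boundsR public using (proper; ∑-proper)

  D : Pred P.Carrier 0ℓ
  D = P.[ ∅ , F ] ∪ ｛ 1P ｝

  outer : List (P.Carrier ∖ D)
  outer = list-∖ (P.[ ∅ , F ]? ∪? (1P P.≟_)) P.elements

  F≢1 : F ≢ 1P
  F≢1 F≡1 = ℤₚ.i≢suc[i] (trans (cong P.rank F≡1) (trans rank-1̂ (ℤₚ.+-comm (P.rank F) 1ℤ)))

  φ≤F : ∀ r → φ r P.≤ F
  φ≤F r = proj₂ (proj₂ (φ-to r))

  φ-surj : ∀ x → x P.≤ F → ∃[ r ] φ r ≡ x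
  φ-surj x x≤F with r , eq ← IsOrderIsomorphism.surjective isOrderIsomorphism (x , Pᵇ.minimum x , x≤F) = r , eq refl

  φ-injective : Injective _≡_ _≡_ φ
  φ-injective e = R.antisym (φ-cancel (P.reflexive e)) (φ-cancel (P.reflexive (sym e)))

  φ-1 : φ 1R ≡ F
  φ-1 with r , φr≡F ← φ-surj F P.≤-refl =
    P.antisym (φ≤F 1R) (subst (P._≤ φ 1R) φr≡F (φ-mono (Rᵇ.maximum r)))

  1≢φ : ∀ r → 1P ≢ φ r
  1≢φ r 1≡φ = F≢1 (P.antisym (Pᵇ.maximum F) (subst (P._≤ F) (sym 1≡φ) (φ≤F r)))

  outer≰F : ((a , _) : P.Carrier ∖ D) → ¬ a P.≤ F
  outer≰F (a , a∉) a≤F = a∉ (inj₁ (Pᵇ.minimum a , a≤F))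

  outer≰φ : ((a , _) : P.Carrier ∖ D) → ∀ r → ¬ a P.≤ φ r
  outer≰φ a r a≤ = outer≰F a (P.≤-trans a≤ (φ≤F r))

  -- The only place where `coatom` enters: the elements above `F` are `F` and `1P`, and both are
  -- deleted. It makes the remaining elements a lower set.
  F≰outer : ((a , _) : P.Carrier ∖ D) → ¬ F P.≤ a
  F≰outer a@(_ , a∉) F≤a with coatom F≤a
  ... | inj₁ refl = outer≰F a P.≤-refl
  ... | inj₂ refl = a∉ (inj₂ refl)

  F≰φ : ((r , _) : R.Carrier ∖ ｛ 1R ｝) → ¬ F P.≤ φ r
  F≰φ r F≤φr = BelowMaximum.1≰ boundsR r (φ-cancel (subst (P._≤ _) (sym φ-1) F≤φr))

  1≰ : ∀ {x} → 1P ≢ x → ¬ 1P P.≤ x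
  1≰ {x} 1≢x = BelowMaximum.1≰ boundsP (x , 1≢x)

  -- `P` without `F` and `1P`, with the elements below `F` named by elements of `R` as in the glued
  -- poset. Both `P` and the glued poset receive a map from this index type, as `μ-lowerSet`
  -- requires.
  Kept : Set
  Kept = (P.Carrier ∖ D) ⊎ (R.Carrier ∖ ｛ 1R ｝)

  inclusion : Kept → P.Carrier
  inclusion = [ proj₁ , φ ∘ proj₁ ]′

  data Position : P.Carrier → Set where
    kept  : ∀ i → Position (inclusion i)
    facet : Position F
    whole : Position 1P

  position : ∀ x → Position x
  position x with (P.[ ∅ , F ]? ∪? (1P P.≟_)) x
  ... | no x∉             = kept (inj₁ (x , x∉))
  ... | yes (inj₂ refl)   = whole
  ... | yes (inj₁ (_ , x≤F)) with φ-surj x x≤F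
  ...   | r , refl with 1R R.≟ r
  ...     | yes refl = subst Position (sym φ-1) facet
  ...     | no 1≢r   = kept (inj₂ (r , 1≢r))

  inclusion-injective : Injective _≡_ _≡_ inclusion
  inclusion-injective {inj₁ a} {inj₁ b} e = cong inj₁ (∖-≡ e)
  inclusion-injective {inj₁ a} {inj₂ r} e = contradiction (P.reflexive e) (outer≰φ a (proj₁ r))
  inclusion-injective {inj₂ r} {inj₁ a} e = contradiction (P.reflexive (sym e)) (outer≰φ a (proj₁ r))
  inclusion-injective {inj₂ r} {inj₂ s} e = cong inj₂ (∖-≡ (φ-injective e))

  1≢inclusion : ∀ i → 1P ≢ inclusion i
  1≢inclusion (inj₁ (a , a∉)) = a∉ ∘ inj₂
  1≢inclusion (inj₂ (r , _))  = 1≢φ r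

  F≰inclusion : ∀ i → ¬ F P.≤ inclusion i
  F≰inclusion (inj₁ a) = F≰outer a
  F≰inclusion (inj₂ r) = F≰φ r

  inclusion-lower : ∀ x j → x P.≤ inclusion j → ∃[ i ] x ≡ inclusion i
  inclusion-lower x j x≤ with position x
  ... | kept i = i , refl
  ... | facet  = contradiction x≤ (F≰inclusion j)
  ... | whole  = contradiction x≤ (1≰ (1≢inclusion j))

  keptElements : List Kept
  keptElements = map inj₁ outer ++ map inj₂ proper

  keptElements-complete : ∀ i → i ∈ keptElements
  keptElements-complete (inj₁ a) = ∈-++⁺ˡ (∈-map⁺ inj₁ (list-∖-complete _ a (P.complete (proj₁ a))))
  keptElements-complete (inj₂ r) = ∈-++⁺ʳ (map inj₁ outer) (∈-map⁺ inj₂ (list-∖-complete _ r (R.complete (proj₁ r))))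

  keptElements-unique : Unique keptElements
  keptElements-unique = Uniqueₚ.++⁺
    (Uniqueₚ.map⁺ (λ { refl → refl }) (list-∖-unique _ P.unique))
    (Uniqueₚ.map⁺ (λ { refl → refl }) (list-∖-unique _ R.unique))
    disjoint
    where
    disjoint : ∀ {i} → ¬ (i ∈ map inj₁ outer × i ∈ map inj₂ proper)
    disjoint (i∈ , j∈) with ∈-map⁻ inj₁ i∈ | ∈-map⁻ inj₂ j∈
    ... | _ , _ , refl | _ , _ , ()

  ∑-position : ∀ h → ∑ℤ P.elements h ≡ ∑ℤ outer (h ∘ proj₁) + (∑ℤ proper (h ∘ φ ∘ proj₁) + (h F + h 1P))
  ∑-position h = begin
    ∑ℤ P.elements h
      ≡⟨ ∑-unique h P.unique uniqueʳ (λ {x} _ → ⊆ x) (λ {x} _ → P.complete x) ⟩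
    ∑ℤ (map inclusion keptElements ++ F ∷ 1P ∷ []) h
      ≡⟨ ∑-++ (map inclusion keptElements) (F ∷ 1P ∷ []) h ⟩
    ∑ℤ (map inclusion keptElements) h + (h F + (h 1P + 0ℤ))
      ≡⟨ cong (_+ (h F + (h 1P + 0ℤ))) (trans (∑-map inclusion keptElements h) (trans
           (∑-++ (map inj₁ outer) (map inj₂ proper) (h ∘ inclusion))
           (cong₂ _+_ (∑-map inj₁ outer (h ∘ inclusion)) (∑-map inj₂ proper (h ∘ inclusion))))) ⟩
    ∑ℤ outer (h ∘ proj₁) + ∑ℤ proper (h ∘ φ ∘ proj₁) + (h F + (h 1P + 0ℤ))
      ≡⟨ regroup (∑ℤ outer (h ∘ proj₁)) (∑ℤ proper (h ∘ φ ∘ proj₁)) (h F) (h 1P) ⟩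
    ∑ℤ outer (h ∘ proj₁) + (∑ℤ proper (h ∘ φ ∘ proj₁) + (h F + h 1P)) ∎
    where
    open ≡-Reasoning
    regroup : ∀ a b c e → a + b + (c + (e + 0ℤ)) ≡ a + (b + (c + e))
    regroup = solve-∀
    disjoint : ∀ {x} → ¬ (x ∈ map inclusion keptElements × x ∈ F ∷ 1P ∷ [])
    disjoint (x∈ , x∈′) with ∈-map⁻ inclusion x∈ | x∈′
    ... | i , _ , refl | here e         = F≰inclusion i (P.reflexive (sym e))
    ... | i , _ , refl | there (here e) = 1≢inclusion i (sym e)
    uniqueʳ : Unique (map inclusion keptElements ++ F ∷ 1P ∷ [])
    uniqueʳ = Uniqueₚ.++⁺ (Uniqueₚ.map⁺ inclusion-injective keptElements-unique)
      ((F≢1 All.∷ All.[]) AllPairs.∷ (All.[] AllPairs.∷ AllPairs.[])) disjoint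
    ⊆ : ∀ x → x ∈ map inclusion keptElements ++ F ∷ 1P ∷ []
    ⊆ x with position x
    ... | kept i = ∈-++⁺ˡ (∈-map⁺ inclusion (keptElements-complete i))
    ... | facet  = ∈-++⁺ʳ (map inclusion keptElements) (here refl)
    ... | whole  = ∈-++⁺ʳ (map inclusion keptElements) (there (here refl))

  -- `R` is a lower set of itself and, through `φ`, of `P`: whatever is below `φ j` is below `F` and
  -- therefore in the image.
  μ-φ : ∀ r s → μP (φ r) (φ s) ≡ μR r s
  μ-φ r s = sym (μ-lowerSet R P R.elements R.complete R.unique id φ id φ-injective
    (λ _ _ → mk⇔ φ-mono φ-cancel) (λ x _ _ → x , refl)
    (λ y j y≤ → let r , e = φ-surj y (P.≤-trans y≤ (φ≤F j)) in r , sym e) r s)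

  ⟪⟫-φ : ∀ k r s → P⟪⟫.⟪ k ⟫ (φ r) (φ s) ≡ R⟪⟫.⟪ k ⟫ r s
  ⟪⟫-φ k r s = begin
    P⟪⟫.⟪ k ⟫ (φ r) (φ s)                                            ≡⟨ P⟪⟫.⟪⟫-μ k (φ r) (φ s) ⟩
    μP (φ r) (φ s) * coeff (z^ ∣ P.rank (φ s) - P.rank (φ r) ∣) k    ≡⟨ cong₂ (λ m n → m * coeff (z^ ∣ n ∣) k) (μ-φ r s)
                                                                          (cong₂ _-_ (rank-preserving s) (rank-preserving r)) ⟩
    μR r s * coeff (z^ ∣ R.rank s - R.rank r ∣) k                    ≡⟨ R⟪⟫.⟪⟫-μ k r s ⟨
    R⟪⟫.⟪ k ⟫ r s                                                    ∎
    where open ≡-Reasoning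

  ∑-outer-row : ((a , _) : P.Carrier ∖ D) (h : P.Carrier → ℤ) → (∀ x → ¬ a P.≤ x → h x ≡ 0ℤ) →
                ∑ℤ P.elements h ≡ ∑ℤ outer (h ∘ proj₁) + h 1P
  ∑-outer-row a h h≰ = trans (∑-position h) (cong (λ n → ∑ℤ outer (h ∘ proj₁) + n) (trans
    (cong₂ (λ m n → m + (n + h 1P)) (∑-zero proper (λ r → h≰ _ (outer≰φ a (proj₁ r)))) (h≰ F (outer≰F a)))
    (trans (ℤₚ.+-identityˡ _) (ℤₚ.+-identityˡ (h 1P)))))

  ∑μ-outer : ((a , _) : P.Carrier ∖ D) → ∑ℤ outer (μP a ∘ proj₁) + μP a 1P ≡ 0ℤ
  ∑μ-outer a = trans (sym (∑-outer-row a (μP (proj₁ a)) (Möbius.μ-≰ P (proj₁ a))))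
                     (P⟪⟫.∑μ≡0 Pᵇ.maximum (proj₁ a) (1≢inclusion (inj₁ a) ∘ sym))

  -- The Möbius function of R sums to zero over [ r , 1R ], so the interval [ φ r , F ] of P contributes nothing.
  ∑μ-φ : ((r , _) : R.Carrier ∖ ｛ 1R ｝) → ∑ℤ outer (μP (φ r) ∘ proj₁) + μP (φ r) 1P ≡ 0ℤ
  ∑μ-φ (r , 1≢r) = begin
    A + E                                                  ≡⟨ cong (_+_ A) (ℤₚ.+-identityˡ E) ⟨
    A + (0ℤ + E)                                           ≡⟨ cong (λ n → A + (n + E)) (R⟪⟫.∑μ≡0 Rᵇ.maximum r (1≢r ∘ sym)) ⟨
    A + (∑ℤ R.elements (μR r) + E)                         ≡⟨ cong (λ n → A + (n + E)) (∑-proper (μR r)) ⟩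
    A + (∑ℤ proper (μR r ∘ proj₁) + μR r 1R + E)           ≡⟨ cong (_+_ A) (ℤₚ.+-assoc (∑ℤ proper (μR r ∘ proj₁)) (μR r 1R) E) ⟩
    A + (∑ℤ proper (μR r ∘ proj₁) + (μR r 1R + E))         ≡⟨ cong (_+_ A) (cong₂ (λ m n → m + (n + E))
                                                                (∑-cong proper (λ (s , _) → μ-φ r s))
                                                                (trans (cong (μP (φ r)) (sym φ-1)) (μ-φ r 1R))) ⟨
    A + (∑ℤ proper (λ (s , _) → μP (φ r) (φ s)) + (μP (φ r) F + E))   ≡⟨ ∑-position (μP (φ r)) ⟨
    ∑ℤ P.elements (μP (φ r))                               ≡⟨ P⟪⟫.∑μ≡0 Pᵇ.maximum (φ r) (1≢φ r ∘ sym) ⟩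
    0ℤ                                                     ∎
    where
    open ≡-Reasoning
    A = ∑ℤ outer (μP (φ r) ∘ proj₁)
    E = μP (φ r) 1P

  -- Only `F` and `1P` lie above `F`, so the vanishing sum has just two nonzero terms, the first of
  -- them 1.
  μ-F1 : μP F 1P ≡ -1ℤ
  μ-F1 = i+j≡0⇒j≡-i 1ℤ _ (begin
    1ℤ + μP F 1P            ≡⟨ cong (_+ μP F 1P) (Möbius.μ-refl P F) ⟨
    μP F F + μP F 1P        ≡⟨ trans (ℤₚ.+-identityˡ _) (ℤₚ.+-identityˡ _) ⟨
    0ℤ + (0ℤ + (μP F F + μP F 1P))
      ≡⟨ cong₂ (λ m n → m + (n + (μP F F + μP F 1P)))
           (∑-zero outer (λ a → Möbius.μ-≰ P F (proj₁ a) (F≰outer a)))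
           (∑-zero proper (λ r → Möbius.μ-≰ P F (φ (proj₁ r)) (F≰φ r))) ⟨
    ∑ℤ outer (μP F ∘ proj₁) + (∑ℤ proper (μP F ∘ φ ∘ proj₁) + (μP F F + μP F 1P))
                            ≡⟨ ∑-position (μP F) ⟨
    ∑ℤ P.elements (μP F)    ≡⟨ P⟪⟫.∑μ≡0 Pᵇ.maximum F F≢1 ⟩
    0ℤ                      ∎)
    where open ≡-Reasoning

  -- The parts of `ℳ P` that survive the gluing. `φ-total` leaves out the columns below `F`: they
  -- repeat entries of `ℳ R`, which `P` and `Q` have in common and which must not be counted twice.
  outer-total φ-total : ℕ → ℤ
  outer-total k = ∑ℤ outer λ (a , _) → ∑ℤ outer (λ (b , _) → P⟪⟫.⟪ k ⟫ a b) + P⟪⟫.⟪ k ⟫ a 1P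
  φ-total k = ∑ℤ proper λ (r , _) → ∑ℤ outer (λ (b , _) → P⟪⟫.⟪ k ⟫ (φ r) b) + P⟪⟫.⟪ k ⟫ (φ r) 1P

  -- In the rows `φ r` the columns up to `F` yield `ℳ R` except for its diagonal entry 1 at `1R`.
  -- The row of `F` yields 1 - z and the row of `1P` yields 1, so one of these units completes `ℳ R`
  -- and 1 - z is left over.
  ℳ-facet : ∀ k → coeff (ℳ P) k ≡ outer-total k + (φ-total k + (coeff (ℳ R) k + coeff 1ₚ k - coeff z k))
  ℳ-facet k = begin
    coeff (ℳ P) k                                                          ≡⟨ P⟪⟫.coeff-ℳ k ⟩
    ∑ℤ P.elements row                                                      ≡⟨ ∑-position row ⟩
    ∑ℤ outer (row ∘ proj₁) + (∑ℤ proper (row ∘ φ ∘ proj₁) + (row F + row 1P))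
      ≡⟨ cong₂ _+_ (∑-cong outer λ a → ∑-outer-row a (P⟪⟫.⟪ k ⟫ (proj₁ a)) (P⟪⟫.⟪⟫-≰ k (proj₁ a)))
           (cong₂ _+_ (trans (∑-cong proper λ (r , _) → row-φ r) (∑-distrib-+ proper
             (λ (r , _) → ∑ℤ outer (λ (b , _) → P⟪⟫.⟪ k ⟫ (φ r) b) + P⟪⟫.⟪ k ⟫ (φ r) 1P)
             (λ (r , _) → ∑ℤ proper (λ (s , _) → R⟪⟫.⟪ k ⟫ r s) + R⟪⟫.⟪ k ⟫ r 1R))) (cong₂ _+_ row-F row-1)) ⟩
    outer-total k + (φ-total k + RR + (w₀ - w₁ + w₀))
      ≡⟨ cong (_+_ (outer-total k)) (regroup (φ-total k) RR w₀ w₁) ⟩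
    outer-total k + (φ-total k + (RR + w₀ + w₀ - w₁))
      ≡⟨ cong (λ n → outer-total k + (φ-total k + (n + w₀ - w₁))) (BelowMaximum.ℳ-proper boundsR k) ⟨
    outer-total k + (φ-total k + (coeff (ℳ R) k + w₀ - w₁))                ∎
    where
    open ≡-Reasoning
    w₀ w₁ RR : ℤ
    w₀ = coeff 1ₚ k
    w₁ = coeff z k
    RR = ∑ℤ proper (λ (r , _) → ∑ℤ proper (λ (s , _) → R⟪⟫.⟪ k ⟫ r s) + R⟪⟫.⟪ k ⟫ r 1R)
    row : P.Carrier → ℤ
    row p = ∑ℤ P.elements (P⟪⟫.⟪ k ⟫ p)

    regroup : ∀ a b c e → a + b + (c - e + c) ≡ a + (b + c + c - e)
    regroup = solve-∀

    row-φ : ∀ r → row (φ r) ≡ ∑ℤ outer (λ (b , _) → P⟪⟫.⟪ k ⟫ (φ r) b) + P⟪⟫.⟪ k ⟫ (φ r) 1P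
                            + (∑ℤ proper (λ (s , _) → R⟪⟫.⟪ k ⟫ r s) + R⟪⟫.⟪ k ⟫ r 1R)
    row-φ r = trans (∑-position (P⟪⟫.⟪ k ⟫ (φ r))) (trans
      (cong₂ (λ m n → A + (m + (n + E))) (∑-cong proper λ (s , _) → ⟪⟫-φ k r s)
        (trans (cong (P⟪⟫.⟪ k ⟫ (φ r)) (sym φ-1)) (⟪⟫-φ k r 1R)))
      (exchange A (∑ℤ proper (λ (s , _) → R⟪⟫.⟪ k ⟫ r s)) (R⟪⟫.⟪ k ⟫ r 1R) E))
      where
      A = ∑ℤ outer (λ (b , _) → P⟪⟫.⟪ k ⟫ (φ r) b)
      E = P⟪⟫.⟪ k ⟫ (φ r) 1P
      exchange : ∀ a b c e → a + (b + (c + e)) ≡ a + e + (b + c)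
      exchange = solve-∀

    row-F : row F ≡ w₀ - w₁
    row-F = trans (∑-position (P⟪⟫.⟪ k ⟫ F)) (trans
      (cong₂ (λ m n → m + (n + (P⟪⟫.⟪ k ⟫ F F + P⟪⟫.⟪ k ⟫ F 1P)))
        (∑-zero outer (λ a → P⟪⟫.⟪⟫-≰ k F (proj₁ a) (F≰outer a)))
        (∑-zero proper (λ r → P⟪⟫.⟪⟫-≰ k F (φ (proj₁ r)) (F≰φ r))))
      (trans (ℤₚ.+-identityˡ _) (trans (ℤₚ.+-identityˡ _) (cong₂ _+_ (P⟪⟫.⟪⟫-refl k F) ⟪F,1⟫))))
      where
      rank-diff : P.rank 1P - P.rank F ≡ 1ℤ
      rank-diff = trans (cong (_- P.rank F) rank-1̂) (cancel (P.rank F))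
        where
        cancel : ∀ x → x + 1ℤ - x ≡ 1ℤ
        cancel = solve-∀
      ⟪F,1⟫ : P⟪⟫.⟪ k ⟫ F 1P ≡ - w₁
      ⟪F,1⟫ = trans (P⟪⟫.⟪⟫-μ k F 1P) (trans
        (cong₂ (λ m n → m * coeff (z^ ∣ n ∣) k) μ-F1 rank-diff) (ℤₚ.-1*i≡-i w₁))

    row-1 : row 1P ≡ w₀
    row-1 = trans (∑-position (P⟪⟫.⟪ k ⟫ 1P)) (trans
      (cong₂ _+_ (∑-zero outer (λ a → P⟪⟫.⟪⟫-≰ k 1P (proj₁ a) (1≰ (1≢inclusion (inj₁ a)))))
        (cong₂ _+_ (∑-zero proper (λ r → P⟪⟫.⟪⟫-≰ k 1P (φ (proj₁ r)) (1≰ (1≢φ (proj₁ r)))))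
          (cong₂ _+_ (P⟪⟫.⟪⟫-≰ k 1P F (1≰ (F≢1 ∘ sym))) (P⟪⟫.⟪⟫-refl k 1P))))
      (trans (ℤₚ.+-identityˡ _) (trans (ℤₚ.+-identityˡ _) (ℤₚ.+-identityˡ _))))

  -- G is the glued poset and t its top; above holds because only outer elements of P
  -- and t lie above an outer element of P.
  module Embedded
    {G : RankedPoset} (e : Kept → RankedPoset.Carrier G)
    (order : ∀ i j → RankedPoset._≤_ G (e i) (e j) ⇔ inclusion i P.≤ inclusion j)
    (lower : ∀ x j → RankedPoset._≤_ G x (e j) → ∃[ i ] x ≡ e i)
    (ranks : ∀ i → RankedPoset.rank G (e i) ≡ P.rank (inclusion i))
    {t : RankedPoset.Carrier G} (maximum : Maximum (RankedPoset._≤_ G) t)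
    (rank-t : RankedPoset.rank G t ≡ P.rank 1P) (e≢t : ∀ i → e i ≢ t)
    (above : ∀ a (h : RankedPoset.Carrier G → ℤ) →
             (∀ x → ¬ RankedPoset._≤_ G (e (inj₁ a)) x → h x ≡ 0ℤ) →
             ∑ℤ (RankedPoset.elements G) h ≡ ∑ℤ outer (h ∘ e ∘ inj₁) + h t)
    where

    private
      module G = RankedPoset G
      module G⟪⟫ = MöbiusProperties G

    e-injective : Injective _≡_ _≡_ e
    e-injective {i} {j} eq = inclusion-injective
      (P.antisym (to (order i j) (G.reflexive eq)) (to (order j i) (G.reflexive (sym eq))))

    μ-kept : ∀ i j → Möbius.μ G (e i) (e j) ≡ μP (inclusion i) (inclusion j)
    μ-kept = μ-lowerSet G P keptElements keptElements-complete keptElements-unique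
      e inclusion e-injective inclusion-injective order lower inclusion-lower

    ⟪⟫-kept : ∀ k i j → G⟪⟫.⟪ k ⟫ (e i) (e j) ≡ P⟪⟫.⟪ k ⟫ (inclusion i) (inclusion j)
    ⟪⟫-kept k i j = trans (G⟪⟫.⟪⟫-μ k (e i) (e j)) (trans
      (cong₂ (λ m n → m * coeff (z^ ∣ n ∣) k) (μ-kept i j) (cong₂ _-_ (ranks j) (ranks i)))
      (sym (P⟪⟫.⟪⟫-μ k (inclusion i) (inclusion j))))

    -- Not an instance of `μ-kept`, because `t` is not in the image of `e`. The sums from `a` vanish
    -- in both posets and agree term by term on the outer elements, so their last terms agree too.
    μ-outer-t : ∀ a → Möbius.μ G (e (inj₁ a)) t ≡ μP (proj₁ a) 1P
    μ-outer-t a = trans (i+j≡0⇒j≡-i S _ (begin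
      S + μG t                                    ≡⟨ cong (_+ μG t) (∑-cong outer (μ-kept (inj₁ a) ∘ inj₁)) ⟨
      ∑ℤ outer (μG ∘ e ∘ inj₁) + μG t             ≡⟨ above a μG (Möbius.μ-≰ G (e (inj₁ a))) ⟨
      ∑ℤ G.elements μG                            ≡⟨ G⟪⟫.∑μ≡0 maximum (e (inj₁ a)) (e≢t (inj₁ a)) ⟩
      0ℤ                                          ∎)) (sym (i+j≡0⇒j≡-i S _ (∑μ-outer a)))
      where
      open ≡-Reasoning
      S = ∑ℤ outer (μP (proj₁ a) ∘ proj₁)
      μG = Möbius.μ G (e (inj₁ a))

    ∑-outer-kept : ∀ k → ∑ℤ outer (λ a → ∑ℤ G.elements (G⟪⟫.⟪ k ⟫ (e (inj₁ a)))) ≡ outer-total k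
    ∑-outer-kept k = ∑-cong outer λ a → trans (above a (G⟪⟫.⟪ k ⟫ (e (inj₁ a))) (G⟪⟫.⟪⟫-≰ k (e (inj₁ a))))
      (cong₂ _+_ (∑-cong outer (⟪⟫-kept k (inj₁ a) ∘ inj₁)) (⟪⟫-t a))
      where
      ⟪⟫-t : ∀ a → G⟪⟫.⟪ k ⟫ (e (inj₁ a)) t ≡ P⟪⟫.⟪ k ⟫ (proj₁ a) 1P
      ⟪⟫-t a = trans (G⟪⟫.⟪⟫-μ k (e (inj₁ a)) t) (trans
        (cong₂ (λ m n → m * coeff (z^ ∣ n ∣) k) (μ-outer-t a) (cong₂ _-_ rank-t (ranks (inj₁ a))))
        (sym (P⟪⟫.⟪⟫-μ k (proj₁ a) 1P)))

-- The glued poset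

module Glued
  {P Q R : RankedPoset} (d : ℤ)
  (boundsP : Bounded P) (boundsQ : Bounded Q) (boundsR : Bounded R)
  {FP : RankedPoset.Carrier P} {FQ : RankedPoset.Carrier Q}
  (isoP : RankIso R P (Bounded.∅ boundsP) FP) (isoQ : RankIso R Q (Bounded.∅ boundsQ) FQ)
  (coatomP : ∀ {a} → RankedPoset._≤_ P FP a → FP ≡ a ⊎ Bounded.1̂ boundsP ≡ a)
  (coatomQ : ∀ {a} → RankedPoset._≤_ Q FQ a → FQ ≡ a ⊎ Bounded.1̂ boundsQ ≡ a)
  (rank-FP : RankedPoset.rank P FP ≡ d - 1ℤ) (rank-1P : RankedPoset.rank P (Bounded.1̂ boundsP) ≡ d)
  (rank-FQ : RankedPoset.rank Q FQ ≡ d - 1ℤ) (rank-1Q : RankedPoset.rank Q (Bounded.1̂ boundsQ) ≡ d)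
  (rank-1R : RankedPoset.rank R (Bounded.1̂ boundsR) ≡ d - 1ℤ)
  (rank-< : ∀ {r} → RankedPoset._<_ R r (Bounded.1̂ boundsR) →
            RankedPoset.rank R r ℤ.< RankedPoset.rank R (Bounded.1̂ boundsR))
  where

  private
    module P = RankedPoset P
    module Q = RankedPoset Q
    module R = RankedPoset R
    open module Gl = Gluing d boundsP boundsQ boundsR isoP isoQ
      using (Gl; Element; inP; inQ; inR; top; elementsP; elementsQ; elementsR)
    module G = RankedPoset Gl
    1P = Bounded.1̂ boundsP
    1Q = Bounded.1̂ boundsQ
    1R = Bounded.1̂ boundsR
    φP = RankIso.φ isoP
    φQ = RankIso.φ isoQ
    module ⟪P⟫ = MöbiusProperties P
    module ⟪Q⟫ = MöbiusProperties Q
    module ⟪R⟫ = MöbiusProperties R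
    module ⟪G⟫ = MöbiusProperties Gl
    module R⁻ = BelowMaximum boundsR
    μP = Möbius.μ P
    μQ = Möbius.μ Q
    μR = Möbius.μ R
    μG = Möbius.μ Gl

  module FacetP = Facet boundsP boundsR isoP coatomP
    (trans rank-1P (trans (i≡i-1+1 d) (cong (_+ 1ℤ) (sym rank-FP))))
  module FacetQ = Facet boundsQ boundsR isoQ coatomQ
    (trans rank-1Q (trans (i≡i-1+1 d) (cong (_+ 1ℤ) (sym rank-FQ))))

  ∑-Gl : ∀ h → ∑ℤ G.elements h ≡
    ∑ℤ elementsP (h ∘ inP) + (∑ℤ elementsQ (h ∘ inQ) + (∑ℤ elementsR (h ∘ inR) + h top))
  ∑-Gl h = trans (∑-++ (map inP elementsP) _ h) (cong₂ _+_ (∑-map inP elementsP h)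
    (trans (∑-++ (map inQ elementsQ) _ h) (cong₂ _+_ (∑-map inQ elementsQ h)
      (trans (∑-++ (map inR elementsR) _ h) (cong₂ _+_ (∑-map inR elementsR h) (ℤₚ.+-identityʳ (h top)))))))

  ≤top : Maximum G._≤_ top
  ≤top (inP _) = tt
  ≤top (inQ _) = tt
  ≤top (inR _) = tt
  ≤top top     = tt

  P⊆Gl : FacetP.Kept → Element
  P⊆Gl = [ inP , inR ]′

  Q⊆Gl : FacetQ.Kept → Element
  Q⊆Gl = [ inQ , inR ]′

  P⊆Gl≢top : ∀ i → P⊆Gl i ≢ top
  P⊆Gl≢top (inj₁ _) ()
  P⊆Gl≢top (inj₂ _) ()

  Q⊆Gl≢top : ∀ i → Q⊆Gl i ≢ top
  Q⊆Gl≢top (inj₁ _) ()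
  Q⊆Gl≢top (inj₂ _) ()

  orderP : ∀ i j → P⊆Gl i G.≤ P⊆Gl j ⇔ FacetP.inclusion i P.≤ FacetP.inclusion j
  orderP (inj₁ _) (inj₁ _) = mk⇔ id id
  orderP (inj₁ _) (inj₂ _) = mk⇔ id id
  orderP (inj₂ _) (inj₁ _) = mk⇔ id id
  orderP (inj₂ _) (inj₂ _) = mk⇔ (RankIso.φ-mono isoP) (RankIso.φ-cancel isoP)

  orderQ : ∀ i j → Q⊆Gl i G.≤ Q⊆Gl j ⇔ FacetQ.inclusion i Q.≤ FacetQ.inclusion j
  orderQ (inj₁ _) (inj₁ _) = mk⇔ id id
  orderQ (inj₁ _) (inj₂ _) = mk⇔ id id
  orderQ (inj₂ _) (inj₁ _) = mk⇔ id id
  orderQ (inj₂ _) (inj₂ _) = mk⇔ (RankIso.φ-mono isoQ) (RankIso.φ-cancel isoQ)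

  -- An element of the Q-part below one of the R-part would lie below `FQ` and so would have been
  -- deleted; below the P-part there is none by definition.
  lowerP : ∀ x j → x G.≤ P⊆Gl j → ∃[ i ] x ≡ P⊆Gl i
  lowerP (inP a) _              _  = inj₁ a , refl
  lowerP (inR r) _              _  = inj₂ r , refl
  lowerP (inQ _) (inj₁ _)       ()
  lowerP (inQ b) (inj₂ (r , _)) b≤ = contradiction b≤ (FacetQ.outer≰φ b r)
  lowerP top     (inj₁ _)       ()
  lowerP top     (inj₂ _)       ()

  lowerQ : ∀ x j → x G.≤ Q⊆Gl j → ∃[ i ] x ≡ Q⊆Gl i
  lowerQ (inQ b) _              _  = inj₁ b , refl
  lowerQ (inR r) _              _  = inj₂ r , refl
  lowerQ (inP _) (inj₁ _)       ()
  lowerQ (inP a) (inj₂ (r , _)) a≤ = contradiction a≤ (FacetP.outer≰φ a r)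
  lowerQ top     (inj₁ _)       ()
  lowerQ top     (inj₂ _)       ()

  ranksP : ∀ i → G.rank (P⊆Gl i) ≡ P.rank (FacetP.inclusion i)
  ranksP (inj₁ _)       = refl
  ranksP (inj₂ (r , _)) = sym (RankIso.rank-preserving isoP r)

  ranksQ : ∀ i → G.rank (Q⊆Gl i) ≡ Q.rank (FacetQ.inclusion i)
  ranksQ (inj₁ _)       = refl
  ranksQ (inj₂ (r , _)) = sym (RankIso.rank-preserving isoQ r)

  aboveP : ∀ a h → (∀ x → ¬ inP a G.≤ x → h x ≡ 0ℤ) → ∑ℤ G.elements h ≡ ∑ℤ elementsP (h ∘ inP) + h top
  aboveP a h h≰ = trans (∑-Gl h) (cong (_+_ (∑ℤ elementsP (h ∘ inP))) (trans
    (cong₂ _+_ (∑-zero elementsQ (λ b → h≰ (inQ b) λ ())) (cong (_+ h top)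
      (∑-zero elementsR (λ r → h≰ (inR r) (FacetP.outer≰φ a (proj₁ r))))))
    (trans (ℤₚ.+-identityˡ _) (ℤₚ.+-identityˡ (h top)))))

  aboveQ : ∀ b h → (∀ x → ¬ inQ b G.≤ x → h x ≡ 0ℤ) → ∑ℤ G.elements h ≡ ∑ℤ elementsQ (h ∘ inQ) + h top
  aboveQ b h h≰ = trans (∑-Gl h) (trans
    (cong₂ _+_ (∑-zero elementsP (λ a → h≰ (inP a) λ ())) (cong (λ n → ∑ℤ elementsQ (h ∘ inQ) + (n + h top))
      (∑-zero elementsR (λ r → h≰ (inR r) (FacetQ.outer≰φ b (proj₁ r))))))
    (trans (ℤₚ.+-identityˡ _) (cong (_+_ (∑ℤ elementsQ (h ∘ inQ))) (ℤₚ.+-identityˡ (h top)))))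

  module GlP = FacetP.Embedded {Gl} P⊆Gl orderP lowerP ranksP ≤top (sym rank-1P)
    P⊆Gl≢top aboveP
  module GlQ = FacetQ.Embedded {Gl} Q⊆Gl orderQ lowerQ ranksQ ≤top (sym rank-1Q)
    Q⊆Gl≢top aboveQ

  μ-R : ∀ r s → μG (inR r) (inR s) ≡ μR (proj₁ r) (proj₁ s)
  μ-R r s = trans (GlP.μ-kept (inj₂ r) (inj₂ s)) (FacetP.μ-φ (proj₁ r) (proj₁ s))

  μ-R-top : (r⁻@(r , _) : R.Carrier ∖ Gl.DR) → μG (inR r⁻) top ≡ μP (φP r) 1P + μQ (φQ r) 1Q + μR r 1R
  μ-R-top r⁻@(r , 1≢r) = begin
    -- The brackets are the vanishing sums of `P`, `Q`, `R` and the glued poset. Those of `P` and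
    -- `Q` come from `∑μ-φ`, with the share of the facet already removed.
    t                                                                    ≡⟨ identity a b c x y w t ⟩
    x + y + w - (a + x) - (b + y) - (c + w) + (a + (b + (c + t)))
      ≡⟨ cong₂ _+_ (cong₂ _-_ (cong₂ _-_ (cong (_-_ (x + y + w)) (FacetP.∑μ-φ r⁻)) (FacetQ.∑μ-φ r⁻)) ∑μR) ∑μG ⟩
    x + y + w - 0ℤ - 0ℤ - 0ℤ + 0ℤ                                        ≡⟨ zeros (x + y + w) ⟩
    x + y + w                                                            ∎
    where
    open ≡-Reasoning
    a = ∑ℤ elementsP (μP (φP r) ∘ proj₁)
    b = ∑ℤ elementsQ (μQ (φQ r) ∘ proj₁)
    c = ∑ℤ elementsR (μR r ∘ proj₁)
    x = μP (φP r) 1P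
    y = μQ (φQ r) 1Q
    w = μR r 1R
    t = μG (inR r⁻) top
    identity : ∀ a b c x y w t → t ≡ x + y + w - (a + x) - (b + y) - (c + w) + (a + (b + (c + t)))
    identity = solve-∀
    zeros : ∀ n → n - 0ℤ - 0ℤ - 0ℤ + 0ℤ ≡ n
    zeros = solve-∀
    ∑μR : c + w ≡ 0ℤ
    ∑μR = trans (sym (R⁻.∑-proper (μR r))) (⟪R⟫.∑μ≡0 (Bounded.maximum boundsR) r (1≢r ∘ sym))
    ∑μG : a + (b + (c + t)) ≡ 0ℤ
    ∑μG = begin
      a + (b + (c + t))                    ≡⟨ cong₂ _+_ (∑-cong elementsP (GlP.μ-kept (inj₂ r⁻) ∘ inj₁))
                                                (cong₂ _+_ (∑-cong elementsQ (GlQ.μ-kept (inj₂ r⁻) ∘ inj₁))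
                                                  (cong (_+ t) (∑-cong elementsR (μ-R r⁻)))) ⟨
      ∑ℤ elementsP (μG (inR r⁻) ∘ inP) + (∑ℤ elementsQ (μG (inR r⁻) ∘ inQ) + (∑ℤ elementsR (μG (inR r⁻) ∘ inR) + t))
                                           ≡⟨ ∑-Gl (μG (inR r⁻)) ⟨
      ∑ℤ G.elements (μG (inR r⁻))          ≡⟨ ⟪G⟫.∑μ≡0 {top} ≤top (inR r⁻) (λ ()) ⟩
      0ℤ                                   ∎

  ⟪⟫-R-top : ∀ k (r⁻@(r , _) : R.Carrier ∖ Gl.DR) → ⟪G⟫.⟪ k ⟫ (inR r⁻) top ≡
    ⟪P⟫.⟪ k ⟫ (φP r) 1P + ⟪Q⟫.⟪ k ⟫ (φQ r) 1Q + coeff (0ℤ ∷ Möbius.μ-z R r 1R) k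
  ⟪⟫-R-top k r⁻@(r , _) = begin
    ⟪G⟫.⟪ k ⟫ (inR r⁻) top                                       ≡⟨ ⟪G⟫.⟪⟫-μ k (inR r⁻) top ⟩
    μG (inR r⁻) top * w (d - R.rank r)                           ≡⟨ cong (_* w (d - R.rank r)) (μ-R-top r⁻) ⟩
    (x + y + t) * w (d - R.rank r)                               ≡⟨ distrib x y t (w (d - R.rank r)) ⟩
    x * w (d - R.rank r) + y * w (d - R.rank r) + t * w (d - R.rank r)
      ≡⟨ cong₂ _+_ (cong₂ _+_ (cong (λ n → x * w n) (cong₂ _-_ rank-1P (RankIso.rank-preserving isoP r)))
                              (cong (λ n → y * w n) (cong₂ _-_ rank-1Q (RankIso.rank-preserving isoQ r))))
                   (cong (λ n → t * w (n - R.rank r)) (trans (cong (_+ 1ℤ) rank-1R) (sym (i≡i-1+1 d)))) ⟨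
    x * w (P.rank 1P - P.rank (φP r)) + y * w (Q.rank 1Q - Q.rank (φQ r)) + t * w (R.rank 1R + 1ℤ - R.rank r)
      ≡⟨ cong₂ _+_ (cong₂ _+_ (⟪P⟫.⟪⟫-μ k (φP r) 1P) (⟪Q⟫.⟪⟫-μ k (φQ r) 1Q)) (R⁻.⟪⟫-shift rank-< k r) ⟨
    ⟪P⟫.⟪ k ⟫ (φP r) 1P + ⟪Q⟫.⟪ k ⟫ (φQ r) 1Q + coeff (0ℤ ∷ Möbius.μ-z R r 1R) k ∎
    where
    open ≡-Reasoning
    w : ℤ → ℤ
    w n = coeff (z^ ∣ n ∣) k
    x = μP (φP r) 1P
    y = μQ (φQ r) 1Q
    t = μR r 1R
    distrib : ∀ a b c e → (a + b + c) * e ≡ a * e + b * e + c * e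
    distrib = solve-∀

  -- `innerR` is what the glued poset retains of `ℳ R`. `shiftR` is the last column of `ℳ R` times z
  -- without the diagonal entry, that is, z g - z.
  innerR shiftR : ℕ → ℤ
  innerR k = ∑ℤ elementsR λ (r , _) → ∑ℤ elementsR λ (s , _) → ⟪R⟫.⟪ k ⟫ r s
  shiftR k = ∑ℤ elementsR λ (r , _) → coeff (0ℤ ∷ Möbius.μ-z R r 1R) k

  ℳ-Gl : ∀ k → coeff (ℳ Gl) k ≡
    FacetP.outer-total k + (FacetQ.outer-total k +
      (FacetP.φ-total k + FacetQ.φ-total k + (innerR k + shiftR k) + coeff 1ₚ k))
  ℳ-Gl k = begin
    coeff (ℳ Gl) k                                     ≡⟨ ⟪G⟫.coeff-ℳ k ⟩
    ∑ℤ G.elements row                                  ≡⟨ ∑-Gl row ⟩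
    ∑ℤ elementsP (row ∘ inP) + (∑ℤ elementsQ (row ∘ inQ) + (∑ℤ elementsR (row ∘ inR) + row top))
      ≡⟨ cong₂ _+_ (GlP.∑-outer-kept k) (cong₂ _+_ (GlQ.∑-outer-kept k) (cong₂ _+_ rows-R row-top)) ⟩
    FacetP.outer-total k + (FacetQ.outer-total k +
      (FacetP.φ-total k + FacetQ.φ-total k + (innerR k + shiftR k) + coeff 1ₚ k)) ∎
    where
    open ≡-Reasoning
    row : Element → ℤ
    row x = ∑ℤ G.elements (⟪G⟫.⟪ k ⟫ x)

    row-top : row top ≡ coeff 1ₚ k
    row-top = trans (∑-Gl (⟪G⟫.⟪ k ⟫ top)) (trans
      (cong₂ _+_ (∑-zero elementsP (λ a → ⟪G⟫.⟪⟫-≰ k top (inP a) λ ()))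
        (cong₂ _+_ (∑-zero elementsQ (λ b → ⟪G⟫.⟪⟫-≰ k top (inQ b) λ ()))
          (cong₂ _+_ (∑-zero elementsR (λ r → ⟪G⟫.⟪⟫-≰ k top (inR r) λ ())) (⟪G⟫.⟪⟫-refl k top))))
      (trans (ℤₚ.+-identityˡ _) (trans (ℤₚ.+-identityˡ _) (ℤₚ.+-identityˡ _))))

    rowP rowQ rowR rowS : R.Carrier ∖ Gl.DR → ℤ
    rowP (r , _) = ∑ℤ elementsP (λ (b , _) → ⟪P⟫.⟪ k ⟫ (φP r) b) + ⟪P⟫.⟪ k ⟫ (φP r) 1P
    rowQ (r , _) = ∑ℤ elementsQ (λ (b , _) → ⟪Q⟫.⟪ k ⟫ (φQ r) b) + ⟪Q⟫.⟪ k ⟫ (φQ r) 1Q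
    rowR (r , _) = ∑ℤ elementsR (λ (s , _) → ⟪R⟫.⟪ k ⟫ r s)
    rowS (r , _) = coeff (0ℤ ∷ Möbius.μ-z R r 1R) k

    row-R : ∀ r → row (inR r) ≡ rowP r + rowQ r + (rowR r + rowS r)
    row-R r⁻@(r , _) = trans (∑-Gl (⟪G⟫.⟪ k ⟫ (inR r⁻))) (trans
      (cong₂ _+_ (∑-cong elementsP (GlP.⟪⟫-kept k (inj₂ r⁻) ∘ inj₁))
        (cong₂ _+_ (∑-cong elementsQ (GlQ.⟪⟫-kept k (inj₂ r⁻) ∘ inj₁))
          (cong₂ _+_ (∑-cong elementsR (λ s → trans (GlP.⟪⟫-kept k (inj₂ r⁻) (inj₂ s)) (FacetP.⟪⟫-φ k r (proj₁ s))))
            (⟪⟫-R-top k r⁻))))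
      (regroup (∑ℤ elementsP (λ (b , _) → ⟪P⟫.⟪ k ⟫ (φP r) b)) (∑ℤ elementsQ (λ (b , _) → ⟪Q⟫.⟪ k ⟫ (φQ r) b))
        (rowR r⁻) (⟪P⟫.⟪ k ⟫ (φP r) 1P) (⟪Q⟫.⟪ k ⟫ (φQ r) 1Q) (rowS r⁻)))
      where
      regroup : ∀ a b c x y t → a + (b + (c + (x + y + t))) ≡ a + x + (b + y) + (c + t)
      regroup = solve-∀

    rows-R : ∑ℤ elementsR (row ∘ inR) ≡ FacetP.φ-total k + FacetQ.φ-total k + (innerR k + shiftR k)
    rows-R = trans (∑-cong elementsR row-R) (trans (∑-distrib-+ elementsR (λ r → rowP r + rowQ r) (λ r → rowR r + rowS r))
      (cong₂ _+_ (∑-distrib-+ elementsR rowP rowQ) (∑-distrib-+ elementsR rowR rowS)))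

  -- By `ℳ-facet`, each of `ℳ P` and `ℳ Q` contains `ℳ R` + (1 - z) beyond what survives in it. The
  -- R-rows and the new top give back `innerR` + `shiftR` + 1, which equals `ℳ R` + (1 - z) - (1 -
  -- z) g. Removing the first amount twice and adding the second gives the correction -1 + z.
  ℳ-glue : ℳ Gl ≈ₚ ℳ P +ₚ ℳ Q -ₚ ℳ R -ₚ 1ₚ +ₚ z -ₚ (1ₚ -ₚ z) *ₚ g R (d - 1ℤ)
  ℳ-glue k = trans (ℳ-Gl k) (sym (begin
    coeff (ℳ P +ₚ ℳ Q -ₚ ℳ R -ₚ 1ₚ +ₚ z -ₚ (1ₚ -ₚ z) *ₚ g R (d - 1ℤ)) k
      ≡⟨ trans (coeff-- (ℳ P +ₚ ℳ Q -ₚ ℳ R -ₚ 1ₚ +ₚ z) _ k) (cong₂ _-_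
           (trans (coeff-+ (ℳ P +ₚ ℳ Q -ₚ ℳ R -ₚ 1ₚ) z k) (cong (_+ coeff z k)
             (trans (coeff-- (ℳ P +ₚ ℳ Q -ₚ ℳ R) 1ₚ k) (cong (_- coeff 1ₚ k)
               (trans (coeff-- (ℳ P +ₚ ℳ Q) (ℳ R) k) (cong (_- coeff (ℳ R) k) (coeff-+ (ℳ P) (ℳ Q) k)))))))
           (coeff-[1-z]* (g R (d - 1ℤ)) k)) ⟩
    coeff (ℳ P) k + coeff (ℳ Q) k - coeff (ℳ R) k - w₀ + w₁
      - (coeff (g R (d - 1ℤ)) k - coeff (0ℤ ∷ g R (d - 1ℤ)) k)
      ≡⟨ cong₂ _-_
           (cong (λ n → n - w₀ + w₁) (cong₂ _-_
             (cong₂ _+_ (trans (FacetP.ℳ-facet k) (cong (λ n → AP + (UP + (n + w₀ - w₁))) mR))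
                        (trans (FacetQ.ℳ-facet k) (cong (λ n → AQ + (UQ + (n + w₀ - w₁))) mR)))
             mR))
           (cong₂ _-_ (trans (cong (λ n → coeff (g R n) k) (sym rank-1R)) (R⁻.coeff-g rank-< k))
                      (trans (cong (λ n → coeff (0ℤ ∷ g R n) k) (sym rank-1R)) (R⁻.coeff-0∷g rank-< k))) ⟩
    AP + (UP + (I + T + w₀ + w₀ - w₁)) + (AQ + (UQ + (I + T + w₀ + w₀ - w₁))) - (I + T + w₀) - w₀ + w₁
      - (T + w₀ - (S + w₁))
      ≡⟨ collect AP AQ UP UQ I T S w₀ w₁ ⟩
    AP + (AQ + (UP + UQ + (I + S) + w₀)) ∎))
    where
    open ≡-Reasoning
    w₀ = coeff 1ₚ k
    w₁ = coeff z k
    AP = FacetP.outer-total k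
    AQ = FacetQ.outer-total k
    UP = FacetP.φ-total k
    UQ = FacetQ.φ-total k
    I = innerR k
    S = shiftR k
    T = ∑ℤ elementsR λ (r , _) → ⟪R⟫.⟪ k ⟫ r 1R
    mR : coeff (ℳ R) k ≡ I + T + w₀
    mR = trans (R⁻.ℳ-proper k) (cong (_+ w₀)
      (∑-distrib-+ elementsR (λ (r , _) → ∑ℤ elementsR (λ (s , _) → ⟪R⟫.⟪ k ⟫ r s)) (λ (r , _) → ⟪R⟫.⟪ k ⟫ r 1R)))
    collect : ∀ ap aq up uq i t s w₀ w₁ →
      ap + (up + (i + t + w₀ + w₀ - w₁)) + (aq + (uq + (i + t + w₀ + w₀ - w₁))) - (i + t + w₀) - w₀ + w₁
        - (t + w₀ - (s + w₁)) ≡ ap + (aq + (up + uq + (i + s) + w₀))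
    collect = solve-∀

-- Facets as coatoms, and the theorem for polytopes

module _ {c ℓ₁ ℓ₂ : Level} {K : OrderedField c ℓ₁ ℓ₂} {P : RankedPoset} {Π : Convex.Polytope K}
         (isFP : IsFacePoset P Π) (boundsP : Bounded P) where
  open RankedPoset P
  open Bounded boundsP

  -- An element strictly between `F` and `1̂` would have a rank strictly between two consecutive
  -- integers.
  facet-coatom : ∀ {F} → rank 1̂ ≡ rank F + 1ℤ → ∀ {a} → F ≤ a → F ≡ a ⊎ 1̂ ≡ a
  facet-coatom {F} rank-1̂ {a} F≤a with F ≟ a | a ≟ 1̂
  ... | yes F≡a | _       = inj₁ F≡a
  ... | no  _   | yes a≡1 = inj₂ (sym a≡1)
  ... | no F≢a  | no a≢1  = contradiction (rank-mono-< (maximum a , a≢1)) (ℤₚ.≤⇒≯ 1≤a)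
    where
    open FacePoset isFP
    1≤a : rank 1̂ ℤ.≤ rank a
    1≤a = subst (ℤ._≤ rank a) (trans (ℤₚ.+-comm 1ℤ (rank F)) (sym rank-1̂))
            (ℤₚ.i<j⇒suc[i]≤j (rank-mono-< (F≤a , F≢a)))

mainTheorem11 : ∀ {c ℓ₁ ℓ₂ : Level} (K : OrderedField c ℓ₁ ℓ₂) (d : ℕ)
    (𝒫 𝒬 ℛ : Convex.Polytope K) →
    Convex.HasDimension K (Convex.Polytope.points 𝒫) (+ d) →
    Convex.HasDimension K (Convex.Polytope.points 𝒬) (+ d) →
    Convex.HasDimension K (Convex.Polytope.points ℛ) (+ d - 1ℤ) →
    (P Q R : RankedPoset) →
    IsFacePoset P 𝒫 → IsFacePoset Q 𝒬 → IsFacePoset R ℛ →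
    (boundsP : Bounded P) (boundsQ : Bounded Q) (boundsR : Bounded R) →
    (FP : RankedPoset.Carrier P) → RankedPoset.rank P FP ≡ + d - 1ℤ →
    (FQ : RankedPoset.Carrier Q) → RankedPoset.rank Q FQ ≡ + d - 1ℤ →
    (φP : RankIso R P (Bounded.∅ boundsP) FP) →
    (φQ : RankIso R Q (Bounded.∅ boundsQ) FQ) →
    ℳ (Gluing.Gl (+ d) boundsP boundsQ boundsR φP φQ)
    ≈ₚ ℳ P +ₚ ℳ Q -ₚ ℳ R -ₚ 1ₚ +ₚ z -ₚ (1ₚ -ₚ z) *ₚ g R (+ d - 1ℤ)
mainTheorem11 K d 𝒫 𝒬 ℛ dim𝒫 dim𝒬 dimℛ P Q R isP isQ isR boundsP boundsQ boundsR FP rank-FP FQ rank-FQ φP φQ =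
  Glued.ℳ-glue (+ d) boundsP boundsQ boundsR φP φQ
    (facet-coatom isP boundsP (step rank-1P rank-FP)) (facet-coatom isQ boundsQ (step rank-1Q rank-FQ))
    rank-FP rank-1P rank-FQ rank-1Q
    (FacePoset.rank-maximum isR (Bounded.maximum boundsR) dimℛ) (FacePoset.rank-mono-< isR)
  where
  rank-1P = FacePoset.rank-maximum isP (Bounded.maximum boundsP) dim𝒫
  rank-1Q = FacePoset.rank-maximum isQ (Bounded.maximum boundsQ) dim𝒬
  step : ∀ {i j} → i ≡ + d → j ≡ + d - 1ℤ → i ≡ j + 1ℤ
  step i≡ j≡ = trans i≡ (trans (i≡i-1+1 (+ d)) (cong (_+ 1ℤ) (sym j≡)))
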